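{- Let $q$ be a prime power, $n\ge1$, and let $L(x)=\sum_{i=0}^{m}a_ix^{q^{2i}}$ with $a_i\in\mathbb F_{q^{2n}}$, $a_m\ne0$, for some integer $0\le m\le n-1$ (so $L$ has degree $q^{2m}$). For $c\in\mathbb F_{q^2}$ let $N_c$ be the number of $x\in\mathbb F_{q^{2n}}$ with $\mathrm{Tr}(xL(x^q))+c=0$. Then for every $c\in\mathbb F_{q^2}$, $|N_c-q^{2(n-1)}|\le(q^2-1)q^{n+2m-1}$, and equality holds if and only if $c=0$ and $\dim\ker(\upsilon L^*+L)=2m+1$ for every $\upsilon\in U$. In this case, $N_0-q^{2(n-1)}=(-1)^{n-1}(q^2-1)q^{n+2m-1}$.
   Context: $\mathrm{Tr}$ is the trace map of $\mathbb F_{q^{2n}}/\mathbb F_{q^2}$. Writing $L(x)=\sum_{i=0}^{n-1}a_ix^{q^{2i}}$ (with $a_i=0$ for $i>m$), $L^*(x)=\sum_{i=0}^{n-1}(a_i^qx)^{q^{2(n-i-1)}}$. $U$ is the subgroup of order $q+1$ of $\mathbb F_{q^2}^*$. $\ker$ denotes the zero set in $\mathbb F_{q^{2n}}$ of a $q^2$-linear polynomial, with dimension over $\mathbb F_{q^2}$. -}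

module Defs where

open import Level using (0ℓ)
open import Data.Nat as ℕ using (ℕ; zero; suc; _∸_; _<_; _≤_)
open import Data.Nat.Primality using (Prime)
open import Data.Fin using (Fin; toℕ; fromℕ<) renaming (zero to fzero; suc to fsuc)
open import Data.Nat using (_<?_)
open import Relation.Nullary using (yes; no)
open import Data.Bool using (Bool; true; false; if_then_else_)
open import Data.Product using (Σ; ∃; _×_; _,_)
open import Relation.Nullary using (¬_; Dec; does)
open import Relation.Binary.PropositionalEquality using (_≡_)
open import Algebra.Bundles using (CommutativeRing)

IsPrimePower : ℕ → Set
IsPrimePower q = Σ ℕ λ p → Σ ℕ λ k → Prime p × (1 ≤ k) × (q ≡ p ℕ.^ k)

countFin : (n : ℕ) → (Fin n → Bool) → ℕ
countFin zero    f = 0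
countFin (suc n) f = (if f fzero then 1 else 0) ℕ.+ countFin n (λ i → f (fsuc i))

record FiniteField : Set₁ where
  field
    commRing : CommutativeRing 0ℓ 0ℓ
  open CommutativeRing commRing public
  field
    1≉0      : ¬ (1# ≈ 0#)
    inverse  : ∀ x → ¬ (x ≈ 0#) → Σ Carrier λ y → x * y ≈ 1#
    _≟_      : ∀ x y → Dec (x ≈ y)
    size     : ℕ
    enum     : Fin size → Carrier
    enum-inj : ∀ i j → enum i ≈ enum j → i ≡ j
    enum-sur : ∀ x → Σ (Fin size) λ i → enum i ≈ x

module FF (F : FiniteField) where
  open FiniteField F public

  infixr 8 _^_
  _^_ : Carrier → ℕ → Carrier
  x ^ zero  = 1#
  x ^ suc k = x * (x ^ k)

  sumTo : ℕ → (ℕ → Carrier) → Carrier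
  sumTo zero    f = 0#
  sumTo (suc k) f = sumTo k f + f k

  count : (P : Carrier → Set) → (∀ x → Dec (P x)) → ℕ
  count P P? = countFin size (λ i → does (P? (enum i)))

  zeroCount : (Carrier → Carrier) → ℕ
  zeroCount f = count (λ x → f x ≈ 0#) (λ x → f x ≟ 0#)

module Setting (F : FiniteField) (q n : ℕ) where
  open FF F public

  InFq2 : Carrier → Set
  InFq2 c = c ^ (q ℕ.* q) ≈ c

  -- U : subgroup of order q+1 of F_{q^2}^*
  InU : Carrier → Set
  InU u = u ^ (q ℕ.+ 1) ≈ 1#

  Tr : Carrier → Carrier
  Tr x = sumTo n (λ i → x ^ (q ℕ.^ (2 ℕ.* i)))

  coeff : (m : ℕ) → (Fin (suc m) → Carrier) → ℕ → Carrier
  coeff m a i with i <? suc m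
  ... | yes i<m+1 = a (fromℕ< i<m+1)
  ... | no  _     = 0#

  Lpoly : (ℕ → Carrier) → Carrier → Carrier
  Lpoly a x = sumTo n (λ i → a i * x ^ (q ℕ.^ (2 ℕ.* i)))

  Lstar : (ℕ → Carrier) → Carrier → Carrier
  Lstar a x = sumTo n (λ i → ((a i ^ q) * x) ^ (q ℕ.^ (2 ℕ.* (n ∸ i ∸ 1))))

  N : (ℕ → Carrier) → Carrier → ℕ
  N a c = zeroCount (λ x → Tr (x * Lpoly a (x ^ q)) + c)

  -- dim_{F_{q^2}} ker f = d, for an F_{q^2}-linear map f, i.e. |ker f| = (q^2)^d
  DimKer : (Carrier → Carrier) → ℕ → Set
  DimKer f d = zeroCount f ≡ (q ℕ.* q) ℕ.^ d

-- Write B(x,y) = Tr(x L(y^q)), Q(x) = B(x,x) and tr(z) = z + z^q.  For t ≠ 0 in F_{q²} the map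
-- h_t(x) = tr(t Q(x)) is a Hermitian form over F_{q²}/F_q whose radical is {x : (υL* + L)(x^q) = 0}
-- with υ = t^(q-1), and N_c is recovered from the values of all the h_t by counting the pairs (t,x)
-- with tr(t (Q(x) + c)) = 0.  With S_t = #{h_t = 0} - #{h_t = 1} (the Gauss sum of h_t, written
-- without characters), counting the pairs with h_t(x) = h_t(y) gives S_t² = q^{2n} |rad h_t|, and
-- |rad h_t| ≤ q^{2(2m+1)} because a power of υL* + L reduces to a polynomial of that degree; this is
-- the bound.  In the extremal case |S_t| = q^{n+2m+1}, and the sign follows from S_t ≡ 1 mod q+1,
-- since h_t is constant on the orbits of U and q ≡ -1 mod q+1.
module Submission where

open import Defs
open import Data.Nat using (ℕ; zero; suc; _∸_; _≤_; _<_; _<?_; _!)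
open import Data.Nat as ℕ using ()
open import Data.Nat.Properties using (n<1+n)
open import Data.Fin using (Fin; fromℕ<; toℕ; fromℕ; punchIn) renaming (zero to fzero; suc to fsuc)
open import Data.Integer using (ℤ; +_; ∣_∣; 0ℤ; 1ℤ; -1ℤ)
open import Data.Integer as ℤ using ()
open import Data.Product using (Σ; ∃; _×_; _,_; proj₁; proj₂)
open import Function.Bundles using (_⇔_; mk⇔)
open import Relation.Nullary using (¬_; Dec; yes; no; does; contradiction)
open import Relation.Binary.PropositionalEquality using (_≡_)
import Relation.Binary.PropositionalEquality as ≡
import Relation.Binary.Reasoning.Setoid as SetoidReasoning
open import Relation.Nullary.Decidable using (¬?; _×-dec_)
open import Level using (0ℓ)
open import Function using (_∘_)
open import Data.Bool using (Bool; true; false; if_then_else_)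
open import Data.Sum using (_⊎_; inj₁; inj₂)
open import Data.Unit using (⊤; tt)
open import Data.Fin.Permutation using (permutation)
import Data.Fin.Properties as Finₚ
import Data.Nat.Properties as ℕₚ
import Data.Nat.Divisibility as ℕDiv
open import Data.Nat.DivMod using (m/n*n≡m)
open import Data.Nat.Combinatorics using (_C_; nCn≡1; nCk≡nC[n∸k]; nCk≡n!/k![n-k]!; k![n∸k]!∣n!)
open import Data.Nat.Primality using (Prime; euclidsLemma; prime⇒nonZero; prime⇒nonTrivial)
import Data.Nat.Tactic.RingSolver as ℕSolver
import Data.Integer.Properties as ℤₚ
import Data.Integer.Divisibility.Signed as Div
open Div using (_∣_)
open import Data.Integer.Tactic.RingSolver using (solve-∀)
open import Algebra.Bundles using (CommutativeMonoid)
import Algebra.Properties.CommutativeMonoid.Sum as MonoidSum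
import Algebra.Properties.CommutativeSemigroup as CommSemigroup
import Algebra.Properties.CommutativeSemiring.Binomial as Binomial
import Algebra.Properties.Ring as RingProperties
import Algebra.Properties.Semiring.Exp as SemiringExp
import Algebra.Properties.Semiring.Mult as SemiringMult
import Algebra.Properties.Semiring.Sum as SemiringSum
import Algebra.Solver.Ring.NaturalCoefficients.Default as SemiringSolver

-- Sums and counting over a finite field

-- Only the size of the big field is given, so the sizes of F_{q²}, F_q and U and of the fibres of
-- the traces and the norm have to be derived. One argument yields them all: root counts bound the
-- fibres and, where its size is still unknown, the target; the product of the two bounds is the
-- known size of the source, so both are attained. `S_t` needs no characters because the nonzero
-- values of `h_t` are equally frequent: multiplying x by z in F_{q²}^* multiplies `h_t` by the norm
-- of z, and norms fill F_q^*. The count takes the form (q-1) q² (N_c - q^{2(n-1)}) = Σ S_t w_c(t)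
-- over t ≠ 0, where w_c(t) is q - 1 if tr(tc) = 0 and -1 otherwise, and the bound is the triangle
-- inequality. Equality makes every |S_t| maximal, hence all S_t equal by the congruence. For c ≠ 0
-- the weights sum to only -(q-1), so that equality is impossible.

χ : {P : Set} → Dec P → ℤ
χ P? = if does P? then 1ℤ else 0ℤ

χ-yes : {P : Set} (P? : Dec P) → P → χ P? ≡ 1ℤ
χ-yes (yes _) _ = ≡.refl
χ-yes (no ¬p) p = contradiction p ¬p

χ-no : {P : Set} (P? : Dec P) → ¬ P → χ P? ≡ 0ℤ
χ-no (yes p) ¬p = contradiction p ¬p
χ-no (no _)  _  = ≡.refl

χ-cong : {P Q : Set} (P? : Dec P) (Q? : Dec Q) → (P → Q) → (Q → P) → χ P? ≡ χ Q?
χ-cong (yes p) Q? f _ = ≡.sym (χ-yes Q? (f p))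
χ-cong (no ¬p) Q? _ g = ≡.sym (χ-no Q? (¬p ∘ g))

χ≥0 : {P : Set} (P? : Dec P) → 0ℤ ℤ.≤ χ P?
χ≥0 (yes _) = ℤ.+≤+ ℕ.z≤n
χ≥0 (no _)  = ℤₚ.≤-refl

χ≤1 : {P : Set} (P? : Dec P) → χ P? ℤ.≤ 1ℤ
χ≤1 (yes _) = ℤₚ.≤-refl
χ≤1 (no _)  = ℤ.+≤+ ℕ.z≤n

χ-mono : {P Q : Set} (P? : Dec P) (Q? : Dec Q) → (P → Q) → χ P? ℤ.≤ χ Q?
χ-mono (yes p) Q? f = ℤₚ.≤-reflexive (≡.sym (χ-yes Q? (f p)))
χ-mono (no ¬p) Q? _ = χ≥0 Q?

-- The hypothesis `P` is available because the other case is multiplied by 0. Facts valid only on a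
-- subset can thus be used under a sum over the whole field.
χ*-cong : {P : Set} (P? : Dec P) {a b : ℤ} → (P → a ≡ b) → χ P? ℤ.* a ≡ χ P? ℤ.* b
χ*-cong (yes p) eq = ≡.cong (1ℤ ℤ.*_) (eq p)
χ*-cong (no _)  _  = ≡.refl

χ*-mono : {P : Set} (P? : Dec P) {a b : ℤ} → (P → a ℤ.≤ b) → χ P? ℤ.* a ℤ.≤ χ P? ℤ.* b
χ*-mono (yes p) {a} {b} le = ≡.subst₂ ℤ._≤_ (≡.sym (ℤₚ.*-identityˡ a)) (≡.sym (ℤₚ.*-identityˡ b)) (le p)
χ*-mono (no _)  _  = ℤₚ.≤-refl

module _ (M : CommutativeMonoid 0ℓ 0ℓ) where
  open CommutativeMonoid M
  open MonoidSum M

  sum-supported-at : ∀ {n} (f : Fin n → Carrier) i → (∀ j → ¬ j ≡ i → f j ≈ ε) → sum f ≈ f i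
  sum-supported-at {suc n} f i zero-off =
    trans (sum-remove {i = i} f)
      (trans (∙-congˡ (trans (sum-cong-≋ (λ j → zero-off (punchIn i j) (Finₚ.punchInᵢ≢i i j))) (sum-replicate-zero n)))
             (identityʳ (f i)))

module FieldSums (F : FiniteField) where
  open FF F

  idx : Carrier → Fin size
  idx x = proj₁ (enum-sur x)

  enum-idx : ∀ x → enum (idx x) ≈ x
  enum-idx x = proj₂ (enum-sur x)

  -- Generic in the monoid, to serve integer sums, sums in the field and products in the field.
  module Fold (M : CommutativeMonoid 0ℓ 0ℓ) where
    private module M = CommutativeMonoid M
    open MonoidSum M

    fold : (Carrier → M.Carrier) → M.Carrier
    fold f = sum (f ∘ enum)

    fold-permute : (f : Carrier → M.Carrier) → (∀ {x y} → x ≈ y → f x M.≈ f y) →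
      (σ τ : Carrier → Carrier) → (∀ {x y} → x ≈ y → σ x ≈ σ y) → (∀ {x y} → x ≈ y → τ x ≈ τ y) →
      (∀ x → σ (τ x) ≈ x) → (∀ x → τ (σ x) ≈ x) → fold (f ∘ σ) M.≈ fold f
    fold-permute f f-cong σ τ σ-cong τ-cong στ τσ = M.sym (M.trans (sum-permute (f ∘ enum) π)
        (sum-cong-≋ (λ i → f-cong (enum-idx (σ (enum i))))))
      where
      π = permutation (λ i → idx (σ (enum i))) (λ i → idx (τ (enum i)))
            (λ i → enum-inj _ _ (trans (enum-idx _) (trans (σ-cong (enum-idx _)) (στ (enum i)))))
            (λ i → enum-inj _ _ (trans (enum-idx _) (trans (τ-cong (enum-idx _)) (τσ (enum i)))))

    fold-supported-at : (f : Carrier → M.Carrier) → (∀ {x y} → x ≈ y → f x M.≈ f y) →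
      ∀ a → (∀ x → ¬ x ≈ a → f x M.≈ M.ε) → fold f M.≈ f a
    fold-supported-at f f-cong a zero-off = M.trans
      (sum-supported-at M (f ∘ enum) (idx a)
        (λ j j≢ → zero-off (enum j) (λ eq → j≢ (enum-inj _ _ (trans eq (sym (enum-idx a)))))))
      (f-cong (enum-idx a))

  open SemiringSum ℤₚ.+-*-semiring using (sum; sum-cong-≗; *-distribˡ-sum; *-distribʳ-sum; ∑-comm; ∑-distrib-+)
  open Fold ℤₚ.+-0-commutativeMonoid

  Ext : (Carrier → ℤ) → Set
  Ext f = ∀ {x y} → x ≈ y → f x ≡ f y

  sum-mono : ∀ {n} {f g : Fin n → ℤ} → (∀ i → f i ℤ.≤ g i) → sum f ℤ.≤ sum g
  sum-mono {zero}  le = ℤₚ.≤-refl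
  sum-mono {suc n} le = ℤₚ.+-mono-≤ (le fzero) (sum-mono (le ∘ fsuc))

  sum-ones : ∀ n → sum {n} (λ _ → 1ℤ) ≡ + n
  sum-ones zero    = ≡.refl
  sum-ones (suc n) = ≡.cong (ℤ._+_ 1ℤ) (sum-ones n)

  sum-∣ : ∀ {n k} {f : Fin n → ℤ} → (∀ i → k ∣ f i) → k ∣ sum f
  sum-∣ {zero}  {k} _ = Div.divides 0ℤ ≡.refl
  sum-∣ {suc n} d = Div.∣m∣n⇒∣m+n (d fzero) (sum-∣ (d ∘ fsuc))

  +countFin : ∀ n (f : Fin n → Bool) → + countFin n f ≡ sum (λ i → if f i then 1ℤ else 0ℤ)
  +countFin zero    f = ≡.refl
  +countFin (suc n) f with f fzero
  ... | true  = ≡.cong (ℤ._+_ 1ℤ) (+countFin n (f ∘ fsuc))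
  ... | false = ≡.trans (+countFin n (f ∘ fsuc)) (≡.sym (ℤₚ.+-identityˡ _))

  -- Opaque, since unfolded integer sums would block the inference of the summands.
  opaque
    ∑ : (Carrier → ℤ) → ℤ
    ∑ = fold

    ∑-cong : ∀ {f g} → (∀ x → f x ≡ g x) → ∑ f ≡ ∑ g
    ∑-cong eq = sum-cong-≗ (λ i → eq (enum i))

    ∑-+ : ∀ f g → ∑ (λ x → f x ℤ.+ g x) ≡ ∑ f ℤ.+ ∑ g
    ∑-+ f g = ∑-distrib-+ (f ∘ enum) (g ∘ enum)

    ∑-*ˡ : ∀ k f → ∑ (λ x → k ℤ.* f x) ≡ k ℤ.* ∑ f
    ∑-*ˡ k f = ≡.sym (*-distribˡ-sum k (f ∘ enum))

    ∑-*ʳ : ∀ k f → ∑ (λ x → f x ℤ.* k) ≡ ∑ f ℤ.* k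
    ∑-*ʳ k f = ≡.sym (*-distribʳ-sum k (f ∘ enum))

    ∑-swap : ∀ (f : Carrier → Carrier → ℤ) → ∑ (λ x → ∑ (λ y → f x y)) ≡ ∑ (λ y → ∑ (λ x → f x y))
    ∑-swap f = ∑-comm (λ i j → f (enum i) (enum j))

    ∑-mono : ∀ {f g} → (∀ x → f x ℤ.≤ g x) → ∑ f ℤ.≤ ∑ g
    ∑-mono le = sum-mono (λ i → le (enum i))

    ∑-one : ∑ (λ _ → 1ℤ) ≡ + size
    ∑-one = sum-ones size

    ∑-permute : ∀ {f} → Ext f → (σ τ : Carrier → Carrier) →
      (∀ {x y} → x ≈ y → σ x ≈ σ y) → (∀ {x y} → x ≈ y → τ x ≈ τ y) →
      (∀ x → σ (τ x) ≈ x) → (∀ x → τ (σ x) ≈ x) → ∑ (λ x → f (σ x)) ≡ ∑ f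
    ∑-permute {f} = fold-permute f

    ∑-supported-at : ∀ {f} → Ext f → ∀ a → (∀ x → ¬ x ≈ a → f x ≡ 0ℤ) → ∑ f ≡ f a
    ∑-supported-at {f} = fold-supported-at f

    ∑-∣ : ∀ {k f} → (∀ x → k ∣ f x) → k ∣ ∑ f
    ∑-∣ d = sum-∣ (λ i → d (enum i))

    +zeroCount : ∀ f → + zeroCount f ≡ ∑ (λ x → χ (f x ≟ 0#))
    +zeroCount f = +countFin size _

  ∑-const : ∀ k → ∑ (λ _ → k) ≡ + size ℤ.* k
  ∑-const k = ≡.trans (∑-cong (λ _ → ≡.sym (ℤₚ.*-identityˡ k))) (≡.trans (∑-*ʳ k (λ _ → 1ℤ)) (≡.cong (ℤ._* k) ∑-one))

  ∑-zero : ∑ (λ _ → 0ℤ) ≡ 0ℤ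
  ∑-zero = ≡.trans (∑-const 0ℤ) (ℤₚ.*-zeroʳ (+ size))

  ∑-- : ∀ f g → ∑ (λ x → f x ℤ.- g x) ≡ ∑ f ℤ.- ∑ g
  ∑-- f g = ≡.trans (∑-+ f (λ x → ℤ.- g x)) (≡.cong (ℤ._+_ (∑ f))
    (≡.trans (∑-cong (λ x → ≡.sym (ℤₚ.-1*i≡-i (g x)))) (≡.trans (∑-*ˡ ℤ.-1ℤ g) (ℤₚ.-1*i≡-i (∑ g)))))

  χ-Ext : {P : Carrier → Set} (P? : ∀ x → Dec (P x)) → (∀ {x y} → x ≈ y → P x → P y) → Ext (χ ∘ P?)
  χ-Ext P? P-resp x≈y = χ-cong (P? _) (P? _) (P-resp x≈y) (P-resp (sym x≈y))

  χ≟-cong : ∀ {a b c d} → a ≈ b → c ≈ d → χ (a ≟ c) ≡ χ (b ≟ d)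
  χ≟-cong a≈b c≈d = χ-cong (_ ≟ _) (_ ≟ _) (λ e → trans (sym a≈b) (trans e c≈d)) (λ e → trans a≈b (trans e (sym c≈d)))

  ∑-δ : ∀ {f} → Ext f → ∀ a → ∑ (λ x → χ (a ≟ x) ℤ.* f x) ≡ f a
  ∑-δ {f} f-ext a = ≡.trans
    (∑-supported-at (λ x≈y → ≡.cong₂ ℤ._*_ (χ≟-cong (refl {a}) x≈y) (f-ext x≈y)) a
      (λ x x≉a → ≡.cong (ℤ._* f x) (χ-no (a ≟ x) (x≉a ∘ sym))))
    (≡.trans (≡.cong (ℤ._* f a) (χ-yes (a ≟ a) refl)) (ℤₚ.*-identityˡ (f a)))

  ∑-δ′ : ∀ {f} → Ext f → ∀ a → ∑ (λ x → χ (x ≟ a) ℤ.* f x) ≡ f a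
  ∑-δ′ {f} f-ext a = ≡.trans (∑-cong (λ x → ≡.cong (ℤ._* f x) (χ-cong (x ≟ a) (a ≟ x) sym sym))) (∑-δ f-ext a)

  ∑-δ1 : ∀ a → ∑ (λ x → χ (x ≟ a)) ≡ 1ℤ
  ∑-δ1 a = ≡.trans (∑-cong (λ x → ≡.sym (ℤₚ.*-identityʳ (χ (x ≟ a))))) (∑-δ′ (λ _ → ≡.refl) a)

  term≤∑ : ∀ {f} → Ext f → (∀ x → 0ℤ ℤ.≤ f x) → ∀ a → f a ℤ.≤ ∑ f
  term≤∑ {f} f-ext nn a = ≡.subst (ℤ._≤ ∑ f) (∑-δ f-ext a) (∑-mono le)
    where
    le : ∀ x → χ (a ≟ x) ℤ.* f x ℤ.≤ f x
    le x with a ≟ x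
    ... | yes _ = ℤₚ.≤-reflexive (ℤₚ.*-identityˡ (f x))
    ... | no _  = nn x

  -- The differences `g x - f x` are nonnegative, and each is at most their sum, which is at most 0.
  -- This turns an attained bound into termwise equalities.
  ∑-squeeze : ∀ {f g} → Ext f → Ext g → (∀ x → f x ℤ.≤ g x) → ∑ g ℤ.≤ ∑ f → ∀ x → f x ≡ g x
  ∑-squeeze {f} {g} f-ext g-ext f≤g ∑g≤∑f x =
    ℤₚ.≤-antisym (f≤g x) (ℤₚ.i-j≤0⇒i≤j (ℤₚ.≤-trans
      (term≤∑ {λ y → g y ℤ.- f y} (λ e → ≡.cong₂ ℤ._-_ (g-ext e) (f-ext e)) (λ y → ℤₚ.i≤j⇒0≤j-i (f≤g y)) x)
      (≡.subst (ℤ._≤ 0ℤ) (≡.sym (∑-- g f)) (ℤₚ.i≤j⇒i-j≤0 ∑g≤∑f))))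

  search : {P : Carrier → Set} (P? : ∀ x → Dec (P x)) → (∀ {x y} → x ≈ y → P x → P y) → Dec (∃ P)
  search P? P-resp with Finₚ.any? (λ i → P? (enum i))
  ... | yes (i , p) = yes (enum i , p)
  ... | no none     = no λ (x , p) → none (idx x , P-resp (sym (enum-idx x)) p)

  -- Decidable subsets and counting by fibres

  record Subset : Set₁ where
    field
      mem  : Carrier → Set
      mem? : ∀ x → Dec (mem x)
      resp : ∀ {x y} → x ≈ y → mem x → mem y

    χₛ : Carrier → ℤ
    χₛ x = χ (mem? x)

    χₛ-ext : Ext χₛ
    χₛ-ext = χ-Ext mem? resp

    ∣_∣ₛ : ℤ
    ∣_∣ₛ = ∑ χₛ

  open Subset public

  fibre : (A : Subset) (f : Carrier → Carrier) → Carrier → ℤ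
  fibre A f s = ∑ (λ x → χₛ A x ℤ.* χ (f x ≟ s))

  fibre-ext : ∀ A f → Ext (fibre A f)
  fibre-ext A f s≈t = ∑-cong (λ x → ≡.cong (χₛ A x ℤ.*_) (χ≟-cong refl s≈t))

  module Fibres (A B : Subset) (f : Carrier → Carrier) (f-maps : ∀ x → mem A x → mem B (f x)) where

    -- Regrouping by the value of `f`: once the sums are interchanged, the indicator of `f x ≟ s`
    -- leaves the single term at `s = f x`, which lies in `B`.
    ∑-fibres : ∀ {g} → Ext g → ∑ (λ s → χₛ B s ℤ.* (fibre A f s ℤ.* g s)) ≡ ∑ (λ x → χₛ A x ℤ.* g (f x))
    ∑-fibres {g} g-ext = begin
      ∑ (λ s → χₛ B s ℤ.* (fibre A f s ℤ.* g s))
        ≡⟨ ∑-cong (λ s → ≡.trans (≡.sym (ℤₚ.*-assoc (χₛ B s) (fibre A f s) (g s)))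
             (≡.trans (reorder (χₛ B s) (fibre A f s) (g s)) (≡.sym (∑-*ˡ (χₛ B s ℤ.* g s) (λ x → χₛ A x ℤ.* χ (f x ≟ s)))))) ⟩
      ∑ (λ s → ∑ (λ x → (χₛ B s ℤ.* g s) ℤ.* (χₛ A x ℤ.* χ (f x ≟ s))))
        ≡⟨ ∑-swap (λ s x → (χₛ B s ℤ.* g s) ℤ.* (χₛ A x ℤ.* χ (f x ≟ s))) ⟩
      ∑ (λ x → ∑ (λ s → (χₛ B s ℤ.* g s) ℤ.* (χₛ A x ℤ.* χ (f x ≟ s))))
        ≡⟨ ∑-cong (λ x → ≡.trans (∑-cong (λ s → shuffle (χₛ B s) (g s) (χₛ A x) (χ (f x ≟ s))))
             (≡.trans (∑-*ˡ (χₛ A x) (λ s → χ (f x ≟ s) ℤ.* (χₛ B s ℤ.* g s))) (≡.cong (χₛ A x ℤ.*_)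
               (∑-δ {λ s → χₛ B s ℤ.* g s} (λ e → ≡.cong₂ ℤ._*_ (χₛ-ext B e) (g-ext e)) (f x))))) ⟩
      ∑ (λ x → χₛ A x ℤ.* (χₛ B (f x) ℤ.* g (f x)))
        ≡⟨ ∑-cong (λ x → χ*-cong (mem? A x) (λ x∈A →
             ≡.trans (≡.cong (ℤ._* g (f x)) (χ-yes (mem? B (f x)) (f-maps x x∈A))) (ℤₚ.*-identityˡ (g (f x))))) ⟩
      ∑ (λ x → χₛ A x ℤ.* g (f x)) ∎
      where
      open ≡.≡-Reasoning
      reorder : ∀ a b c → a ℤ.* b ℤ.* c ≡ (a ℤ.* c) ℤ.* b
      reorder = solve-∀
      shuffle : ∀ a b c d → (a ℤ.* b) ℤ.* (c ℤ.* d) ≡ c ℤ.* (d ℤ.* (a ℤ.* b))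
      shuffle = solve-∀

    ∑-fibre : ∑ (λ s → χₛ B s ℤ.* fibre A f s) ≡ ∣ A ∣ₛ
    ∑-fibre = ≡.trans (∑-cong (λ s → ≡.cong (χₛ B s ℤ.*_) (≡.sym (ℤₚ.*-identityʳ (fibre A f s)))))
      (≡.trans (∑-fibres {λ _ → 1ℤ} (λ _ → ≡.refl)) (∑-cong (λ x → ℤₚ.*-identityʳ (χₛ A x))))

  -- Counting A fibrewise forces equality in |B| ≤ b and in all the bounds on the fibres.
  module Equidistribution (A B : Subset) (f : Carrier → Carrier) (f-maps : ∀ x → mem A x → mem B (f x))
           (a b : ℕ) .{{_ : ℕ.NonZero a}} (∣B∣≤b : ∣ B ∣ₛ ℤ.≤ + b)
           (fibre≤a : ∀ s → mem B s → fibre A f s ℤ.≤ + a)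
           (∣A∣≡ab : ∣ A ∣ₛ ≡ + (a ℕ.* b)) where
    open Fibres A B f f-maps

    private
      ∑a : ∑ (λ s → χₛ B s ℤ.* + a) ≡ ∣ B ∣ₛ ℤ.* + a
      ∑a = ∑-*ʳ (+ a) (χₛ B)

      ab≡ba : + (a ℕ.* b) ≡ + b ℤ.* + a
      ab≡ba = ≡.trans (≡.cong +_ (ℕₚ.*-comm a b)) (ℤₚ.pos-* b a)

      le : ∀ s → χₛ B s ℤ.* fibre A f s ℤ.≤ χₛ B s ℤ.* + a
      le s = χ*-mono (mem? B s) (fibre≤a s)

    fibres-full : ∀ s → mem B s → fibre A f s ≡ + a
    fibres-full s s∈B = ≡.trans (≡.sym (unit (fibre A f s))) (≡.trans
        (∑-squeeze {λ s → χₛ B s ℤ.* fibre A f s} {λ s → χₛ B s ℤ.* + a} (λ e → ≡.cong₂ ℤ._*_ (χₛ-ext B e) (fibre-ext A f e))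
                   (λ e → ≡.cong (ℤ._* + a) (χₛ-ext B e)) le total s)
        (unit (+ a)))
      where
      unit : ∀ k → χₛ B s ℤ.* k ≡ k
      unit k = ≡.trans (≡.cong (ℤ._* k) (χ-yes (mem? B s) s∈B)) (ℤₚ.*-identityˡ k)
      total : ∑ (λ s → χₛ B s ℤ.* + a) ℤ.≤ ∑ (λ s → χₛ B s ℤ.* fibre A f s)
      total = ≡.subst₂ ℤ._≤_ (≡.sym ∑a) (≡.sym (≡.trans ∑-fibre (≡.trans ∣A∣≡ab ab≡ba)))
                (ℤₚ.*-monoʳ-≤-nonNeg (+ a) ∣B∣≤b)

    target-full : ∣ B ∣ₛ ≡ + b
    target-full = ℤₚ.≤-antisym ∣B∣≤b (lower {{ℤ.positive (ℤ.+<+ (ℕ.>-nonZero⁻¹ a))}})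
      where
      lower : {{_ : ℤ.Positive (+ a)}} → + b ℤ.≤ ∣ B ∣ₛ
      lower = ℤₚ.*-cancelʳ-≤-pos (+ b) ∣ B ∣ₛ (+ a)
        (≡.subst₂ ℤ._≤_ (≡.trans ∑-fibre (≡.trans ∣A∣≡ab ab≡ba)) ∑a (∑-mono le))

-- Polynomial functions and their roots

module FieldPowers (F : FiniteField) where
  open FF F
  open SemiringSolver commutativeSemiring using (solve; _:=_; _:+_; _:*_)
  open CommSemigroup *-commutativeSemigroup using (interchange)
  open RingProperties ring public using (-0#≈0#; -‿involutive; +-inverseʳ-unique)
    renaming (x∙y⁻¹≈ε⇒x≈y to x-y≈0⇒x≈y)
  open SetoidReasoning setoid

  x*y≈0⇒ : ∀ {x y} → x * y ≈ 0# → ¬ x ≈ 0# → y ≈ 0#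
  x*y≈0⇒ {x} {y} xy≈0 x≉0 with inverse x x≉0
  ... | x⁻¹ , xx⁻¹≈1 = begin
    y               ≈⟨ *-identityˡ y ⟨
    1# * y          ≈⟨ *-congʳ (trans (sym xx⁻¹≈1) (*-comm x x⁻¹)) ⟩
    (x⁻¹ * x) * y   ≈⟨ *-assoc x⁻¹ x y ⟩
    x⁻¹ * (x * y)   ≈⟨ *-congˡ xy≈0 ⟩
    x⁻¹ * 0#        ≈⟨ zeroʳ x⁻¹ ⟩
    0#              ∎

  *-≉0 : ∀ {x y} → ¬ x ≈ 0# → ¬ y ≈ 0# → ¬ x * y ≈ 0#
  *-≉0 x≉0 y≉0 xy≈0 = y≉0 (x*y≈0⇒ xy≈0 x≉0)

  *-cancelˡ : ∀ {x y z} → ¬ x ≈ 0# → x * y ≈ x * z → y ≈ z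
  *-cancelˡ {x} {y} {z} x≉0 eq = x-y≈0⇒x≈y y z (x*y≈0⇒ x[y-z]≈0 x≉0)
    where
    x[y-z]≈0 : x * (y + - z) ≈ 0#
    x[y-z]≈0 = trans (distribˡ x y (- z)) (trans (+-congʳ eq)
      (trans (sym (distribˡ x z (- z))) (trans (*-congˡ (-‿inverseʳ z)) (zeroʳ x))))

  ^-cong : ∀ {x y} k → x ≈ y → x ^ k ≈ y ^ k
  ^-cong zero    _   = refl
  ^-cong (suc k) x≈y = *-cong x≈y (^-cong k x≈y)

  ^-exp : ∀ x {k l} → k ≡ l → x ^ k ≈ x ^ l
  ^-exp x ≡.refl = refl

  ^-+ : ∀ x k l → x ^ (k ℕ.+ l) ≈ x ^ k * x ^ l
  ^-+ x zero    l = sym (*-identityˡ _)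
  ^-+ x (suc k) l = trans (*-congˡ (^-+ x k l)) (sym (*-assoc x _ _))

  ^-distrib-* : ∀ x y k → (x * y) ^ k ≈ x ^ k * y ^ k
  ^-distrib-* x y zero    = sym (*-identityˡ 1#)
  ^-distrib-* x y (suc k) = trans (*-congˡ (^-distrib-* x y k)) (interchange x y _ _)

  1^ : ∀ k → 1# ^ k ≈ 1#
  1^ zero    = refl
  1^ (suc k) = trans (*-identityˡ _) (1^ k)

  ^-* : ∀ x k l → (x ^ k) ^ l ≈ x ^ (k ℕ.* l)
  ^-* x zero    l = 1^ l
  ^-* x (suc k) l = begin
    (x * x ^ k) ^ l           ≈⟨ ^-distrib-* x (x ^ k) l ⟩
    x ^ l * (x ^ k) ^ l       ≈⟨ *-congˡ (^-* x k l) ⟩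
    x ^ l * x ^ (k ℕ.* l)     ≈⟨ ^-+ x l (k ℕ.* l) ⟨
    x ^ (l ℕ.+ k ℕ.* l)       ∎

  ^-1 : ∀ x → x ^ 1 ≈ x
  ^-1 x = *-identityʳ x

  0^ : ∀ k .{{_ : ℕ.NonZero k}} → 0# ^ k ≈ 0#
  0^ (suc k) = zeroˡ _

  ^-≉0 : ∀ {x} k → ¬ x ≈ 0# → ¬ x ^ k ≈ 0#
  ^-≉0 zero    x≉0 = 1≉0
  ^-≉0 (suc k) x≉0 = *-≉0 x≉0 (^-≉0 k x≉0)

  ^≈0⇒≈0 : ∀ {x} k → x ^ k ≈ 0# → x ≈ 0#
  ^≈0⇒≈0 {x} k xᵏ≈0 with x ≟ 0#
  ... | yes x≈0 = x≈0
  ... | no x≉0  = contradiction xᵏ≈0 (^-≉0 k x≉0)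

  ^≈1⇒≉0 : ∀ {x} k .{{_ : ℕ.NonZero k}} → x ^ k ≈ 1# → ¬ x ≈ 0#
  ^≈1⇒≉0 k xᵏ≈1 x≈0 = 1≉0 (trans (sym xᵏ≈1) (trans (^-cong k x≈0) (0^ k)))

  sumTo-cong : ∀ n {f g} → (∀ i → i < n → f i ≈ g i) → sumTo n f ≈ sumTo n g
  sumTo-cong zero    eq = refl
  sumTo-cong (suc n) eq = +-cong (sumTo-cong n (λ i i<n → eq i (ℕₚ.m<n⇒m<1+n i<n))) (eq n (ℕₚ.n<1+n n))

  sumTo-zero : ∀ n {f} → (∀ i → i < n → f i ≈ 0#) → sumTo n f ≈ 0#
  sumTo-zero zero    eq = refl
  sumTo-zero (suc n) eq = trans (+-cong (sumTo-zero n (λ i i<n → eq i (ℕₚ.m<n⇒m<1+n i<n))) (eq n (ℕₚ.n<1+n n))) (+-identityʳ 0#)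

  sumTo-+ : ∀ n f g → sumTo n (λ i → f i + g i) ≈ sumTo n f + sumTo n g
  sumTo-+ zero    f g = sym (+-identityʳ 0#)
  sumTo-+ (suc n) f g = trans (+-congʳ (sumTo-+ n f g))
    (solve 4 (λ a b c d → (a :+ b) :+ (c :+ d) := (a :+ c) :+ (b :+ d)) refl _ _ _ _)

  sumTo-*ˡ : ∀ n c f → sumTo n (λ i → c * f i) ≈ c * sumTo n f
  sumTo-*ˡ zero    c f = sym (zeroʳ c)
  sumTo-*ˡ (suc n) c f = trans (+-congʳ (sumTo-*ˡ n c f)) (sym (distribˡ c _ _))

  sumTo-map : (h : Carrier → Carrier) → h 0# ≈ 0# → (∀ x y → h (x + y) ≈ h x + h y) →
    ∀ n f → h (sumTo n f) ≈ sumTo n (λ i → h (f i))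
  sumTo-map h h0 h+ zero    f = h0
  sumTo-map h h0 h+ (suc n) f = trans (h+ _ _) (+-congʳ (sumTo-map h h0 h+ n f))

  sumTo-shift : ∀ n f → sumTo n (λ i → f (suc i)) + f 0 ≈ sumTo n f + f n
  sumTo-shift zero    f = refl
  sumTo-shift (suc n) f = begin
    (sumTo n (λ i → f (suc i)) + f (suc n)) + f 0   ≈⟨ solve 3 (λ a b c → (a :+ b) :+ c := (a :+ c) :+ b) refl _ _ _ ⟩
    (sumTo n (λ i → f (suc i)) + f 0) + f (suc n)   ≈⟨ +-congʳ (sumTo-shift n f) ⟩
    (sumTo n f + f n) + f (suc n)                   ∎

module Polynomials (F : FiniteField) where
  open FF F
  open FieldSums F
  open FieldPowers F
  open SemiringSolver commutativeSemiring using (solve; _:=_; _:+_; _:*_)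
  open SetoidReasoning setoid

  -- Poly d c f: f is given by a polynomial of degree at most d whose coefficient at x^d is c (possibly zero).
  data Poly : ℕ → Carrier → (Carrier → Carrier) → Set where
    const  : ∀ {c f} → (∀ x → f x ≈ c) → Poly 0 c f
    horner : ∀ {d c f g} r → Poly d c g → (∀ x → f x ≈ x * g x + r) → Poly (suc d) c f

  poly-cong : ∀ {d c f g} → (∀ x → g x ≈ f x) → Poly d c f → Poly d c g
  poly-cong eq (const e)      = const (λ x → trans (eq x) (e x))
  poly-cong eq (horner r p e) = horner r p (λ x → trans (eq x) (e x))

  poly-coeff : ∀ {d c c′ f} → c ≈ c′ → Poly d c f → Poly d c′ f
  poly-coeff eq (const e)      = const (λ x → trans (e x) eq)
  poly-coeff eq (horner r p e) = horner r (poly-coeff eq p) e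

  poly-resp : ∀ {d c f} → Poly d c f → ∀ {x y} → x ≈ y → f x ≈ f y
  poly-resp (const e)      x≈y = trans (e _) (sym (e _))
  poly-resp (horner r p e) x≈y = trans (e _) (trans (+-congʳ (*-cong x≈y (poly-resp p x≈y))) (sym (e _)))

  poly-+ : ∀ {d c c′ f g} → Poly d c f → Poly d c′ g → Poly d (c + c′) (λ x → f x + g x)
  poly-+ (const e)      (const e′)        = const (λ x → +-cong (e x) (e′ x))
  poly-+ (horner r p e) (horner r′ p′ e′) = horner (r + r′) (poly-+ p p′)
    (λ x → trans (+-cong (e x) (e′ x))
      (solve 5 (λ x a r b r′ → (x :* a :+ r) :+ (x :* b :+ r′) := x :* (a :+ b) :+ (r :+ r′)) refl x _ r _ r′))

  poly-* : ∀ {d c f} k → Poly d c f → Poly d (k * c) (λ x → k * f x)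
  poly-* k (const e)      = const (λ x → *-congˡ (e x))
  poly-* k (horner r p e) = horner (k * r) (poly-* k p)
    (λ x → trans (*-congˡ (e x)) (solve 4 (λ k x a r → k :* (x :* a :+ r) := x :* (k :* a) :+ k :* r) refl k x _ r))

  poly-suc : ∀ {d c f} → Poly d c f → Poly (suc d) 0# f
  poly-suc (const {c} e)  = horner c (const {f = λ _ → 0#} (λ _ → refl))
    (λ x → trans (e x) (sym (trans (+-congʳ (zeroʳ x)) (+-identityˡ c))))
  poly-suc (horner r p e) = horner r (poly-suc p) e

  -- Padding with zero leading coefficients, so that terms of different degrees can be added at a
  -- common degree.
  poly-< : ∀ {d e c f} → d < e → Poly d c f → Poly e 0# f
  poly-< {d} {suc e} (ℕ.s≤s d≤e) p with ℕₚ.m≤n⇒m<n∨m≡n d≤e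
  ... | inj₁ d<e     = poly-suc (poly-< d<e p)
  ... | inj₂ ≡.refl  = poly-suc p

  poly-^ : ∀ d → Poly d 1# (λ x → x ^ d)
  poly-^ zero    = const (λ _ → refl)
  poly-^ (suc d) = horner 0# (poly-^ d) (λ x → sym (+-identityʳ _))

  poly-zero : ∀ d → Poly d 0# (λ _ → 0#)
  poly-zero zero    = const (λ _ → refl)
  poly-zero (suc d) = poly-suc (poly-zero d)

  poly-low-+ : ∀ {d c f g} → Poly d 0# f → Poly d c g → Poly d c (λ x → f x + g x)
  poly-low-+ p p′ = poly-coeff (+-identityˡ _) (poly-+ p p′)

  poly-sumTo : ∀ {d} n {f : ℕ → Carrier → Carrier} → (∀ i → i < n → Poly d 0# (f i)) →
    Poly d 0# (λ x → sumTo n (λ i → f i x))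
  poly-sumTo zero    _ = poly-zero _
  poly-sumTo (suc n) p = poly-low-+ (poly-sumTo n (λ i i<n → p i (ℕₚ.m<n⇒m<1+n i<n))) (p n (ℕₚ.n<1+n n))

  poly-sumTo-leading : ∀ {d c m} n {f : ℕ → Carrier → Carrier} → m < n →
    (∀ i → ¬ i ≡ m → Poly d 0# (f i)) → Poly d c (f m) → Poly d c (λ x → sumTo n (λ i → f i x))
  poly-sumTo-leading (suc n) (ℕ.s≤s m≤n) low top with ℕₚ.m≤n⇒m<n∨m≡n m≤n
  ... | inj₁ m<n    = poly-coeff (+-identityʳ _)
          (poly-+ (poly-sumTo-leading n m<n low top) (low n (λ n≡m → ℕₚ.<⇒≢ m<n (≡.sym n≡m))))
  ... | inj₂ ≡.refl = poly-low-+ (poly-sumTo n (λ i i<n → low i (ℕₚ.<⇒≢ i<n))) top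

  poly-shift : ∀ {d c f} s → 0 < d → Poly d c f → Poly d c (λ x → f x + s)
  poly-shift s 0<d p = poly-coeff (+-identityʳ _) (poly-+ p (poly-< 0<d (const {s} (λ _ → refl))))

  -- Synthetic division by x - α. The variable `u` stands for x - α, so that the identities involved
  -- contain no subtraction and the semiring solver applies; the leading coefficient `c` passes to
  -- the quotient.
  factor : ∀ {d c f} → Poly (suc d) c f → ∀ α →
    Σ (Carrier → Carrier) λ g → Poly d c g × (∀ x u → x ≈ α + u → f x ≈ f α + u * g x)
  factor {zero} {c} (horner {g = g} r (const e) e′) α = (λ _ → c) , const (λ _ → refl) , λ x u x≈α+u → begin
    _                             ≈⟨ e′ x ⟩
    x * g x + r                   ≈⟨ +-congʳ (*-cong x≈α+u (e x)) ⟩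
    (α + u) * c + r               ≈⟨ solve 4 (λ α u c r → (α :+ u) :* c :+ r := (α :* c :+ r) :+ u :* c) refl α u c r ⟩
    (α * c + r) + u * c           ≈⟨ +-congʳ (+-congʳ (*-congˡ (e α))) ⟨
    (α * g α + r) + u * c         ≈⟨ +-congʳ (e′ α) ⟨
    _                             ∎
  factor {suc d} (horner {g = g} r p e) α with factor p α
  ... | k , pk , gx≈ = (λ x → α * k x + g x) , poly-low-+ (poly-suc (poly-* α pk)) p , λ x u x≈α+u → begin
    _                               ≈⟨ e x ⟩
    x * g x + r                     ≈⟨ +-congʳ (*-congʳ x≈α+u) ⟩
    (α + u) * g x + r               ≈⟨ solve 4 (λ α u c r → (α :+ u) :* c :+ r := (α :* c :+ r) :+ u :* c) refl α u (g x) r ⟩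
    (α * g x + r) + u * g x         ≈⟨ +-congʳ (+-congʳ (*-congˡ (gx≈ x u x≈α+u))) ⟩
    (α * (g α + u * k x) + r) + u * g x
      ≈⟨ solve 6 (λ α a u k r b → (α :* (a :+ u :* k) :+ r) :+ u :* b := (α :* a :+ r) :+ u :* (α :* k :+ b)) refl α (g α) u (k x) r (g x) ⟩
    (α * g α + r) + u * (α * k x + g x) ≈⟨ +-congʳ (e α) ⟨
    _                               ∎

  -- Induction on the degree: once a root α is split off, every other root is a root of the
  -- quotient, because a field has no zero divisors.
  root-bound : ∀ {d c f} → Poly d c f → ¬ c ≈ 0# → ∑ (λ x → χ (f x ≟ 0#)) ℤ.≤ + d
  root-bound (const {f = f} e) c≉0 =
    ℤₚ.≤-reflexive (≡.trans (∑-cong (λ x → χ-no (f x ≟ 0#) (λ fx≈0 → c≉0 (trans (sym (e x)) fx≈0)))) ∑-zero)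
  root-bound {suc d} {f = f} p c≉0 with search (λ x → f x ≟ 0#) (λ e → trans (poly-resp p (sym e)))
  ... | no none = ≡.subst (ℤ._≤ + suc d)
          (≡.sym (≡.trans (∑-cong (λ x → χ-no (f x ≟ 0#) (λ fx≈0 → none (x , fx≈0)))) ∑-zero)) (ℤ.+≤+ ℕ.z≤n)
  ... | yes (α , fα≈0) with factor p α
  ...   | g , pg , fx≈ = ℤₚ.≤-trans (∑-mono le)
            (≡.subst (ℤ._≤ + suc d) (≡.sym (≡.trans (∑-+ (λ x → χ (x ≟ α)) (λ x → χ (g x ≟ 0#))) (≡.cong (ℤ._+ ∑ (λ x → χ (g x ≟ 0#))) (∑-δ1 α))))
              (ℤₚ.+-monoʳ-≤ 1ℤ (root-bound pg c≉0)))
    where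
    le : ∀ x → χ (f x ≟ 0#) ℤ.≤ χ (x ≟ α) ℤ.+ χ (g x ≟ 0#)
    le x with x ≟ α
    ... | yes _  = ℤₚ.≤-trans (χ≤1 (f x ≟ 0#)) (ℤₚ.+-monoʳ-≤ 1ℤ (χ≥0 (g x ≟ 0#)))
    ... | no x≉α = ≡.subst (χ (f x ≟ 0#) ℤ.≤_) (≡.sym (ℤₚ.+-identityˡ _)) (χ-mono (f x ≟ 0#) (g x ≟ 0#) root)
      where
      root : f x ≈ 0# → g x ≈ 0#
      root fx≈0 = x*y≈0⇒
        (trans (sym (trans (+-congʳ fα≈0) (+-identityˡ _)))
          (trans (sym (fx≈ x (x + - α) (sym (trans (+-comm α _) (trans (+-assoc x _ α) (trans (+-congˡ (-‿inverseˡ α)) (+-identityʳ x)))))))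
                 fx≈0))
        (λ x-α≈0 → x≉α (x-y≈0⇒x≈y x α x-α≈0))

  -- Points of the fibre are roots of `f - s`; as `d` is positive, the shift by `s` leaves the
  -- leading coefficient alone.
  fibre-bound : ∀ {d c f} → 0 < d → Poly d c f → ¬ c ≈ 0# → ∀ A s → fibre A f s ℤ.≤ + d
  fibre-bound {f = f} 0<d p c≉0 A s = ℤₚ.≤-trans (∑-mono le) (root-bound (poly-shift (- s) 0<d p) c≉0)
    where
    le : ∀ x → χₛ A x ℤ.* χ (f x ≟ s) ℤ.≤ χ ((f x + - s) ≟ 0#)
    le x with mem? A x
    ... | yes _ = ≡.subst (ℤ._≤ χ ((f x + - s) ≟ 0#)) (≡.sym (ℤₚ.*-identityˡ (χ (f x ≟ s))))
                    (χ-mono (f x ≟ s) ((f x + - s) ≟ 0#) (λ e → trans (+-congʳ e) (-‿inverseʳ s)))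
    ... | no _  = χ≥0 ((f x + - s) ≟ 0#)

-- Characteristic and Frobenius

prime∤k! : ∀ {p} → Prime p → ∀ k → k < p → ¬ p ℕDiv.∣ k !
prime∤k! {p} pr zero    _   p∣1 = ℕ.nonTrivial⇒≢1 {{prime⇒nonTrivial pr}} (ℕDiv.∣1⇒≡1 p∣1)
prime∤k! {p} pr (suc k) k<p p∣k! with euclidsLemma (suc k) (k !) pr p∣k!
... | inj₁ p∣1+k = ℕₚ.<⇒≱ k<p (ℕDiv.∣⇒≤ p∣1+k)
... | inj₂ p∣k!′ = prime∤k! pr k (ℕₚ.<-trans (ℕₚ.n<1+n k) k<p) p∣k!′

-- The prime divides p! = (p C k) k! (p - k)!, but neither of the two factorials on the right.
prime∣pCk : ∀ {p} → Prime p → ∀ {k} → 0 < k → k < p → p ℕDiv.∣ p C k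
prime∣pCk {p@(suc p′)} pr {k} 0<k k<p
  with euclidsLemma (p C k) (k ! ℕ.* (p ∸ k) !) pr
         (≡.subst (p ℕDiv.∣_) (≡.sym pCk*d≡p!) (ℕDiv.m∣m*n (p′ !)))
  where
  instance _ = k ℕₚ.!* (p ∸ k) !≢0
  pCk*d≡p! : (p C k) ℕ.* (k ! ℕ.* (p ∸ k) !) ≡ p !
  pCk*d≡p! = ≡.trans (≡.cong (ℕ._* (k ! ℕ.* (p ∸ k) !)) (nCk≡n!/k![n-k]! (ℕₚ.<⇒≤ k<p)))
               (m/n*n≡m (k![n∸k]!∣n! (ℕₚ.<⇒≤ k<p)))
... | inj₁ p∣C = p∣C
... | inj₂ p∣d with euclidsLemma (k !) ((p ∸ k) !) pr p∣d
...   | inj₁ p∣k!   = contradiction p∣k! (prime∤k! pr k k<p)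
...   | inj₂ p∣p-k! = contradiction p∣p-k! (prime∤k! pr (p ∸ k) (ℕₚ.∸-monoʳ-< 0<k (ℕₚ.<⇒≤ k<p)))

module FieldCharacteristic (F : FiniteField) where
  open FF F
  open FieldSums F
  open FieldPowers F
  open SetoidReasoning setoid
  open SemiringMult semiring using (×1-homo-*; ×-assoc-*; ×-congʳ; ×-homo-1; ×-assocˡ) renaming (_×_ to _·_)
  open SemiringExp semiring using () renaming (_^_ to _^′_)

  private
    module Add = Fold +-commutativeMonoid
    module Mul = Fold *-commutativeMonoid
    module AddSum = MonoidSum +-commutativeMonoid
    module MulSum = MonoidSum *-commutativeMonoid

    ^≡^′ : ∀ x k → x ^ k ≡ x ^′ k
    ^≡^′ x zero    = ≡.refl
    ^≡^′ x (suc k) = ≡.cong (x *_) (^≡^′ x k)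

    prod-≉0 : ∀ {k} (f : Fin k → Carrier) → (∀ i → ¬ f i ≈ 0#) → ¬ MulSum.sum f ≈ 0#
    prod-≉0 {zero}  f nz = 1≉0
    prod-≉0 {suc k} f nz = *-≉0 (nz fzero) (prod-≉0 (f ∘ fsuc) (nz ∘ fsuc))

    prod-const : ∀ k x → MulSum.sum {k} (λ _ → x) ≈ x ^ k
    prod-const zero    x = refl
    prod-const (suc k) x = *-congˡ (prod-const k x)

    size-nonZero : ℕ.NonZero size
    size-nonZero with size | idx 0#
    ... | suc _ | _ = _

    if0 : Carrier → Carrier → Carrier → Carrier
    if0 y u v with y ≟ 0#
    ... | yes _ = u
    ... | no _  = v

    if0-yes : ∀ {y} → y ≈ 0# → ∀ u v → if0 y u v ≈ u
    if0-yes {y} y≈0 u v with y ≟ 0#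
    ... | yes _  = refl
    ... | no y≉0 = contradiction y≈0 y≉0

    if0-no : ∀ {y} → ¬ y ≈ 0# → ∀ u v → if0 y u v ≈ v
    if0-no {y} y≉0 u v with y ≟ 0#
    ... | yes y≈0 = contradiction y≈0 y≉0
    ... | no _    = refl

    if0-cong : ∀ {y z u v w} → y ≈ z → v ≈ w → if0 y u v ≈ if0 z u w
    if0-cong {y} {z} {u} {v} {w} y≈z v≈w with z ≟ 0#
    ... | yes z≈0 = if0-yes (trans y≈z z≈0) u v
    ... | no z≉0  = trans (if0-no (λ y≈0 → z≉0 (trans (sym y≈z) y≈0)) u v) v≈w

  -- Multiplication by x permutes the nonzero elements, so x^(size-1) = 1 when x ≠ 0.
  fermat : ∀ x → x ^ size ≈ x
  fermat x with x ≟ 0#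
  ... | yes x≈0 = trans (^-cong size x≈0) (trans (0^ size {{size-nonZero}}) (sym x≈0))
  ... | no x≉0 with inverse x x≉0
  ...   | x⁻¹ , xx⁻¹≈1 = begin
    x ^ size                      ≈⟨ prod-const size x ⟨
    Mul.fold (λ _ → x)            ≈⟨ MulSum.sum-cong-≋ (λ i → factors (enum i)) ⟩
    Mul.fold (λ y → k y * k′ y)   ≈⟨ MulSum.∑-distrib-+ (k ∘ enum) (k′ ∘ enum) ⟩
    Mul.fold k * Mul.fold k′      ≈⟨ *-cong ∏k≈1 ∏k′≈x ⟩
    1# * x                        ≈⟨ *-identityˡ x ⟩
    x                             ∎
    where
    -- The enumeration contains 0, so the usual product over nonzero elements is patched there: `g`
    -- replaces 0 by 1, `k` is the factor by which `g` changes under multiplication by x, and `k′`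
    -- supplies the factor x that `k` omits at 0. Hence x^size = ∏ k · ∏ k′ = 1 · x.
    g k k′ : Carrier → Carrier
    g y  = if0 y 1# y
    k y  = if0 y 1# x
    k′ y = if0 y x 1#

    g-cong : ∀ {y z} → y ≈ z → g y ≈ g z
    g-cong y≈z = if0-cong y≈z y≈z

    factors : ∀ y → x ≈ k y * k′ y
    factors y with y ≟ 0#
    ... | yes _ = sym (*-identityˡ x)
    ... | no _  = sym (*-identityʳ x)

    g-scale : ∀ y → g (x * y) ≈ k y * g y
    g-scale y with y ≟ 0#
    ... | yes y≈0 = trans (if0-yes (trans (*-congˡ y≈0) (zeroʳ x)) 1# (x * y)) (sym (*-identityˡ 1#))
    ... | no y≉0  = if0-no (*-≉0 x≉0 y≉0) 1# (x * y)

    g≉0 : ∀ y → ¬ g y ≈ 0#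
    g≉0 y with y ≟ 0#
    ... | yes _  = 1≉0
    ... | no y≉0 = y≉0

    ∏g≈ : Mul.fold g * Mul.fold k ≈ Mul.fold g * 1#
    ∏g≈ = begin
      Mul.fold g * Mul.fold k           ≈⟨ *-comm _ _ ⟩
      Mul.fold k * Mul.fold g           ≈⟨ MulSum.∑-distrib-+ (k ∘ enum) (g ∘ enum) ⟨
      Mul.fold (λ y → k y * g y)        ≈⟨ MulSum.sum-cong-≋ (λ i → g-scale (enum i)) ⟨
      Mul.fold (λ y → g (x * y))        ≈⟨ Mul.fold-permute g g-cong (x *_) (x⁻¹ *_) *-congˡ *-congˡ
                                             (cancel xx⁻¹≈1) (cancel (trans (*-comm x⁻¹ x) xx⁻¹≈1)) ⟩
      Mul.fold g                        ≈⟨ *-identityʳ _ ⟨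
      Mul.fold g * 1#                   ∎
      where
      cancel : ∀ {a b} → a * b ≈ 1# → ∀ y → a * (b * y) ≈ y
      cancel ab≈1 y = trans (sym (*-assoc _ _ y)) (trans (*-congʳ ab≈1) (*-identityˡ y))

    ∏k≈1 : Mul.fold k ≈ 1#
    ∏k≈1 = *-cancelˡ (prod-≉0 (g ∘ enum) (λ i → g≉0 (enum i))) ∏g≈

    ∏k′≈x : Mul.fold k′ ≈ x
    ∏k′≈x = trans (Mul.fold-supported-at k′ (λ y≈z → if0-cong y≈z refl) 0# (λ y y≉0 → if0-no y≉0 x 1#))
              (if0-yes refl x 1#)

  -- Translation by 1 permutes the field, so the sum of all elements does not change when 1 is added
  -- to each of them.
  size·1≈0 : size · 1# ≈ 0#
  size·1≈0 = begin
    size · 1#             ≈⟨ AddSum.sum-replicate size ⟨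
    Add.fold (λ _ → 1#)   ≈⟨ +-cancelˡ′ _ _ shifted ⟩
    0#                    ∎
    where
    +-cancelˡ′ : ∀ s y → s + y ≈ s + 0# → y ≈ 0#
    +-cancelˡ′ s y eq = trans (sym (+-identityˡ y)) (trans (+-congʳ (sym (-‿inverseˡ s)))
      (trans (+-assoc _ _ _) (trans (+-congˡ eq) (trans (+-congˡ (+-identityʳ s)) (-‿inverseˡ s)))))
    shift-cancel : ∀ {a b} → a + b ≈ 0# → ∀ y → (y + a) + b ≈ y
    shift-cancel a+b≈0 y = trans (+-assoc y _ _) (trans (+-congˡ a+b≈0) (+-identityʳ y))
    shifted : Add.fold (λ y → y) + Add.fold (λ _ → 1#) ≈ Add.fold (λ y → y) + 0#
    shifted = begin
      Add.fold (λ y → y) + Add.fold (λ _ → 1#)  ≈⟨ AddSum.∑-distrib-+ enum (λ _ → 1#) ⟨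
      Add.fold (λ y → y + 1#)                   ≈⟨ Add.fold-permute (λ y → y) (λ e → e) (_+ 1#) (_+ (- 1#)) +-congʳ +-congʳ
                                                     (shift-cancel (-‿inverseˡ 1#)) (shift-cancel (-‿inverseʳ 1#)) ⟩
      Add.fold (λ y → y)                        ≈⟨ +-identityʳ _ ⟨
      Add.fold (λ y → y) + 0#                   ∎

  -- The k-th power of `p · 1#` is `size · 1#`, which is 0, and a field has no nilpotent elements
  -- but 0.
  char≈0 : ∀ p k → size ≡ p ℕ.^ k → p · 1# ≈ 0#
  char≈0 p k size≡pᵏ = ^≈0⇒≈0 k (trans (sym (power k)) (trans (reflexive (≡.cong (_· 1#) (≡.sym size≡pᵏ))) size·1≈0))
    where
    power : ∀ k → (p ℕ.^ k) · 1# ≈ (p · 1#) ^ k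
    power zero    = ×-homo-1 1#
    power (suc k) = trans (×1-homo-* p (p ℕ.^ k)) (*-congˡ (power k))

  module _ {p : ℕ} (pr : Prime p) (p·1≈0 : p · 1# ≈ 0#) where

    multiple≈0 : ∀ {k} → p ℕDiv.∣ k → ∀ x → k · x ≈ 0#
    multiple≈0 (ℕDiv.divides j ≡.refl) x = begin
      (j ℕ.* p) · x           ≈⟨ ×-assocˡ x j p ⟨
      j · (p · x)             ≈⟨ ×-congʳ j (trans (×-congʳ p (sym (*-identityˡ x))) (sym (×-assoc-* p 1# x))) ⟩
      j · ((p · 1#) * x)      ≈⟨ ×-congʳ j (trans (*-congʳ p·1≈0) (zeroˡ x)) ⟩
      j · 0#                  ≈⟨ j·0 j ⟩
      0#                      ∎
      where
      j·0 : ∀ j → j · 0# ≈ 0#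
      j·0 zero    = refl
      j·0 (suc j) = trans (+-identityˡ _) (j·0 j)

    -- In the binomial expansion all coefficients but the two outer ones are divisible by p and
    -- vanish in the field.
    frobenius-prime : ∀ x y → (x + y) ^ p ≈ x ^ p + y ^ p
    frobenius-prime x y = go p ≡.refl
      where
      -- The prime has to be matched as a successor: the terms are indexed by `Fin (suc p)`, and
      -- after the first is removed the last one sits at `fromℕ p′`.
      go : ∀ p₀ → p₀ ≡ p → (x + y) ^ p₀ ≈ x ^ p₀ + y ^ p₀
      go zero     eq = contradiction (≡.sym eq) (ℕ.≢-nonZero⁻¹ p {{prime⇒nonZero pr}})
      go (suc p′) ≡.refl = begin
        (x + y) ^ p                          ≡⟨ ^≡^′ (x + y) p ⟩
        (x + y) ^′ p                         ≈⟨ Bin.theorem p x y ⟩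
        term fzero + AddSum.sum (term ∘ fsuc) ≈⟨ +-cong first (trans (sum-supported-at +-commutativeMonoid (term ∘ fsuc) (fromℕ p′) middle) last) ⟩
        y ^ p + x ^ p                        ≈⟨ +-comm _ _ ⟩
        x ^ p + y ^ p                        ∎
        where
        module Bin = Binomial commutativeSemiring
        term : Fin (suc p) → Carrier
        term = Bin.binomialTerm x y p

        first : term fzero ≈ y ^ p
        first = begin
          (p C 0) · (1# * y ^′ p)  ≡⟨ ≡.cong (_· (1# * y ^′ p)) (≡.trans (nCk≡nC[n∸k] {0} {p} ℕ.z≤n) (nCn≡1 p)) ⟩
          1 · (1# * y ^′ p)        ≈⟨ ×-homo-1 _ ⟩
          1# * y ^′ p              ≈⟨ *-identityˡ _ ⟩
          y ^′ p                   ≡⟨ ^≡^′ y p ⟨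
          y ^ p                    ∎

        middle : ∀ j → ¬ j ≡ fromℕ p′ → term (fsuc j) ≈ 0#
        middle j j≢ = multiple≈0 (prime∣pCk pr (ℕ.s≤s ℕ.z≤n) (ℕ.s≤s (ℕₚ.≤∧≢⇒< (ℕ.s≤s⁻¹ (Finₚ.toℕ<n j))
          (λ e → j≢ (Finₚ.toℕ-injective (≡.trans e (≡.sym (Finₚ.toℕ-fromℕ p′)))))))) _

        last : term (fsuc (fromℕ p′)) ≈ x ^ p
        last rewrite Finₚ.toℕ-fromℕ p′ | nCn≡1 p | ℕₚ.n∸n≡0 p′ = begin
          1 · (x ^′ p * 1#)        ≈⟨ ×-homo-1 _ ⟩
          x ^′ p * 1#              ≈⟨ *-identityʳ _ ⟩
          x ^′ p                   ≡⟨ ^≡^′ x p ⟨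
          x ^ p                    ∎

    frobenius : ∀ k x y → (x + y) ^ (p ℕ.^ k) ≈ x ^ (p ℕ.^ k) + y ^ (p ℕ.^ k)
    frobenius zero    x y = trans (^-1 _) (sym (+-cong (^-1 x) (^-1 y)))
    frobenius (suc k) x y = begin
      (x + y) ^ (p ℕ.* p ℕ.^ k)                         ≈⟨ ^-* (x + y) p (p ℕ.^ k) ⟨
      ((x + y) ^ p) ^ (p ℕ.^ k)                         ≈⟨ ^-cong (p ℕ.^ k) (frobenius-prime x y) ⟩
      (x ^ p + y ^ p) ^ (p ℕ.^ k)                       ≈⟨ frobenius k (x ^ p) (y ^ p) ⟩
      (x ^ p) ^ (p ℕ.^ k) + (y ^ p) ^ (p ℕ.^ k)         ≈⟨ +-cong (^-* x p (p ℕ.^ k)) (^-* y p (p ℕ.^ k)) ⟩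
      x ^ (p ℕ.* p ℕ.^ k) + y ^ (p ℕ.* p ℕ.^ k)         ∎

-- Traces, norms and subfields

primePower≥2 : ∀ {q} → IsPrimePower q → 1 < q
primePower≥2 (p , suc k , pr , _ , ≡.refl) =
  ℕₚ.<-≤-trans (ℕ.nonTrivial⇒n>1 p {{prime⇒nonTrivial pr}}) (ℕₚ.m≤m*n p (p ℕ.^ k) {{ℕₚ.m^n≢0 p k {{prime⇒nonZero pr}}}})

module SubsetExistence (F : FiniteField) where
  open FF F
  open FieldSums F

  -- Turns a count into a witness: if the exhaustive search fails, every summand of the fibre is 0.
  fibre≢0⇒∃ : ∀ A f → (∀ {x y} → x ≈ y → f x ≈ f y) → ∀ s → ¬ fibre A f s ≡ 0ℤ →
    ∃ λ x → mem A x × f x ≈ s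
  fibre≢0⇒∃ A f f-cong s nz
    with search (λ x → mem? A x ×-dec (f x ≟ s)) (λ e (m , eq) → resp A e m , trans (f-cong (sym e)) eq)
  ... | yes p   = p
  ... | no none = contradiction (≡.trans (∑-cong vanish) ∑-zero) nz
    where
    vanish : ∀ x → χₛ A x ℤ.* χ (f x ≟ s) ≡ 0ℤ
    vanish x = ≡.trans (χ*-cong (mem? A x) (λ m → χ-no (f x ≟ s) (λ eq → none (x , m , eq)))) (ℤₚ.*-zeroʳ (χₛ A x))

  nonzero : Subset → Subset
  nonzero A = record
    { mem  = λ x → mem A x × ¬ x ≈ 0#
    ; mem? = λ x → mem? A x ×-dec ¬? (x ≟ 0#)
    ; resp = λ e (m , x≉0) → resp A e m , λ y≈0 → x≉0 (trans e y≈0)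
    }

  χ-nonzero : ∀ A → mem A 0# → ∀ x → χₛ (nonzero A) x ≡ χₛ A x ℤ.- χ (x ≟ 0#)
  χ-nonzero A 0∈A x with x ≟ 0#
  ... | yes x≈0 = ≡.trans (χ-no (mem? A x ×-dec ¬? (yes x≈0)) (λ (_ , x≉0) → x≉0 x≈0))
                    (≡.sym (≡.cong (ℤ._- 1ℤ) (χ-yes (mem? A x) (resp A (sym x≈0) 0∈A))))
  ... | no x≉0  = ≡.trans (χ-cong (mem? A x ×-dec ¬? (no x≉0)) (mem? A x) proj₁ (λ m → m , x≉0))
                    (≡.sym (ℤₚ.+-identityʳ (χₛ A x)))

  ∣nonzero∣ : ∀ A → mem A 0# → ∣ nonzero A ∣ₛ ≡ ∣ A ∣ₛ ℤ.- 1ℤ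
  ∣nonzero∣ A 0∈A = ≡.trans (∑-cong (χ-nonzero A 0∈A))
    (≡.trans (∑-- (χₛ A) (λ x → χ (x ≟ 0#))) (≡.cong (λ z → ∣ A ∣ₛ ℤ.- z) (∑-δ1 0#)))

  everything : Subset
  everything = record { mem = λ _ → ⊤ ; mem? = λ _ → yes tt ; resp = λ _ _ → tt }

  fibre-everything : ∀ f s → fibre everything f s ≡ ∑ (λ x → χ (f x ≟ s))
  fibre-everything f s = ∑-cong (λ x → ℤₚ.*-identityˡ (χ (f x ≟ s)))

module FieldTower (q n : ℕ) (q-pp : IsPrimePower q) (1≤n : 1 ≤ n)
                  (F : FiniteField) (size≡ : FiniteField.size F ≡ q ℕ.^ (2 ℕ.* n)) where
  open Setting F q n
  open FieldSums F
  open SubsetExistence F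
  open FieldPowers F
  open Polynomials F
  open FieldCharacteristic F
  open SemiringSolver commutativeSemiring using (solve; _:=_; _:+_; _:*_)
  open SetoidReasoning setoid

  1<q : 1 < q
  1<q = primePower≥2 q-pp

  instance
    q-nonZero : ℕ.NonZero q
    q-nonZero = ℕ.>-nonZero (ℕₚ.<-trans (ℕ.s≤s ℕ.z≤n) 1<q)

  -- Writing q as `suc r` keeps identities in q - 1 and q² - 1 = r (q + 1) free of truncated
  -- subtraction.
  r : ℕ
  r = q ∸ 1

  q≡1+r : q ≡ suc r
  q≡1+r = ≡.sym (ℕₚ.m+[n∸m]≡n (ℕₚ.<⇒≤ 1<q))

  0<r : 0 < r
  0<r = ℕₚ.m<n⇒0<n∸m 1<q

  -- Iterates of the q-Frobenius, indexed by the exponent of q, so that composition is addition of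
  -- indices and index 2n is the identity.
  fr : ℕ → Carrier → Carrier
  fr k x = x ^ (q ℕ.^ k)

  fr-cong : ∀ k {x y} → x ≈ y → fr k x ≈ fr k y
  fr-cong k = ^-cong (q ℕ.^ k)

  fr-index : ∀ {k l} x → k ≡ l → fr k x ≈ fr l x
  fr-index x ≡.refl = refl

  fr-* : ∀ k x y → fr k (x * y) ≈ fr k x * fr k y
  fr-* k x y = ^-distrib-* x y (q ℕ.^ k)

  fr-∘ : ∀ k l x → fr l (fr k x) ≈ fr (k ℕ.+ l) x
  fr-∘ k l x = trans (^-* x (q ℕ.^ k) (q ℕ.^ l)) (^-exp x (≡.sym (ℕₚ.^-distribˡ-+-* q k l)))

  fr-0 : ∀ x → fr 0 x ≈ x
  fr-0 = ^-1

  fr-1 : ∀ x → fr 1 x ≈ x ^ q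
  fr-1 x = ^-exp x (ℕₚ.*-identityʳ q)

  fr-2 : ∀ x → fr 2 x ≈ x ^ (q ℕ.* q)
  fr-2 x = ^-exp x (≡.cong (q ℕ.*_) (ℕₚ.*-identityʳ q))

  fr-2n : ∀ x → fr (2 ℕ.* n) x ≈ x
  fr-2n x = trans (^-exp x (≡.sym size≡)) (fermat x)

  fr-+ : ∀ k x y → fr k (x + y) ≈ fr k x + fr k y
  fr-+ k x y = go q-pp
    where
    go : IsPrimePower q → fr k (x + y) ≈ fr k x + fr k y
    go (p , j , pr , _ , q≡pʲ) = trans (^-exp (x + y) (qᵏ k)) (trans
        (frobenius pr (char≈0 p (j ℕ.* (2 ℕ.* n)) (≡.trans size≡ (qᵏ (2 ℕ.* n)))) (j ℕ.* k) x y)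
        (+-cong (^-exp x (≡.sym (qᵏ k))) (^-exp y (≡.sym (qᵏ k)))))
      where
      qᵏ : ∀ k → q ℕ.^ k ≡ p ℕ.^ (j ℕ.* k)
      qᵏ k = ≡.trans (≡.cong (ℕ._^ k) q≡pʲ) (ℕₚ.^-*-assoc p j k)

  fr-zero : ∀ k → fr k 0# ≈ 0#
  fr-zero k = 0^ (q ℕ.^ k) {{ℕₚ.m^n≢0 q k}}

  fr-neg : ∀ k x → fr k (- x) ≈ - fr k x
  fr-neg k x = +-inverseʳ-unique _ _ (trans (sym (fr-+ k x (- x))) (trans (fr-cong k (-‿inverseʳ x)) (fr-zero k)))

  fr-sumTo : ∀ k m f → fr k (sumTo m f) ≈ sumTo m (λ i → fr k (f i))
  fr-sumTo k = sumTo-map (fr k) (fr-zero k) (fr-+ k)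

  ^q-+ : ∀ x y → (x + y) ^ q ≈ x ^ q + y ^ q
  ^q-+ x y = trans (sym (fr-1 (x + y))) (trans (fr-+ 1 x y) (+-cong (fr-1 x) (fr-1 y)))

  ^q^q : ∀ x → (x ^ q) ^ q ≈ x ^ (q ℕ.* q)
  ^q^q x = ^-* x q q

  -- `E` and `K` are F_{q²} and F_q, given as fixed points of Frobenius powers. Root counts bound
  -- their sizes at once; the exact sizes come from counting `Tr` and `tr`.
  E K E* K* U : Subset
  E = record { mem = InFq2 ; mem? = λ x → (x ^ (q ℕ.* q)) ≟ x
             ; resp = λ e m → trans (^-cong (q ℕ.* q) (sym e)) (trans m e) }
  K = record { mem = λ x → x ^ q ≈ x ; mem? = λ x → (x ^ q) ≟ x
             ; resp = λ e m → trans (^-cong q (sym e)) (trans m e) }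
  U = record { mem = InU ; mem? = λ x → (x ^ (q ℕ.+ 1)) ≟ 1#
             ; resp = λ e m → trans (^-cong (q ℕ.+ 1) (sym e)) m }
  E* = nonzero E
  K* = nonzero K

  0∈E : mem E 0#
  0∈E = 0^ (q ℕ.* q) {{ℕₚ.m*n≢0 q q}}

  0∈K : mem K 0#
  0∈K = 0^ q

  E-* : ∀ {x y} → mem E x → mem E y → mem E (x * y)
  E-* {x} {y} mx my = trans (^-distrib-* x y (q ℕ.* q)) (*-cong mx my)

  E-fr : ∀ {x} → mem E x → ∀ i → fr (2 ℕ.* i) x ≈ x
  E-fr {x} m zero    = fr-0 x
  E-fr {x} m (suc i) = begin
    fr (2 ℕ.* suc i) x        ≈⟨ fr-index x (ℕₚ.*-suc 2 i) ⟩
    fr (2 ℕ.+ 2 ℕ.* i) x      ≈⟨ fr-∘ 2 (2 ℕ.* i) x ⟨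
    fr (2 ℕ.* i) (fr 2 x)     ≈⟨ fr-cong (2 ℕ.* i) (trans (fr-2 x) m) ⟩
    fr (2 ℕ.* i) x            ≈⟨ E-fr m i ⟩
    x                         ∎

  K-neg : ∀ {x} → mem K x → mem K (- x)
  K-neg {x} m = trans (sym (fr-1 (- x))) (trans (fr-neg 1 x) (-‿cong (trans (fr-1 x) m)))

  E-+ : ∀ {x y} → mem E x → mem E y → mem E (x + y)
  E-+ {x} {y} mx my = trans (sym (fr-2 (x + y))) (trans (fr-+ 2 x y) (+-cong (trans (fr-2 x) mx) (trans (fr-2 y) my)))

  Tr-cong : ∀ {x y} → x ≈ y → Tr x ≈ Tr y
  Tr-cong e = sumTo-cong n (λ i _ → fr-cong (2 ℕ.* i) e)

  Tr-+ : ∀ x y → Tr (x + y) ≈ Tr x + Tr y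
  Tr-+ x y = trans (sumTo-cong n (λ i _ → fr-+ (2 ℕ.* i) x y)) (sumTo-+ n _ _)

  Tr-0 : Tr 0# ≈ 0#
  Tr-0 = sumTo-zero n (λ i _ → fr-zero (2 ℕ.* i))

  Tr-linear : ∀ {c} → mem E c → ∀ x → Tr (c * x) ≈ c * Tr x
  Tr-linear {c} m x = trans (sumTo-cong n (λ i _ → trans (fr-* (2 ℕ.* i) c x) (*-congʳ (E-fr m i)))) (sumTo-*ˡ n c _)

  -- Raising to the power q² shifts the summands of the trace cyclically, since index 2n returns x
  -- itself.
  Tr-fr2 : ∀ x → sumTo n (λ i → fr (2 ℕ.* suc i) x) ≈ Tr x
  Tr-fr2 x = begin
    S                                       ≈⟨ +-identityʳ S ⟨
    S + 0#                                  ≈⟨ +-congˡ (-‿inverseʳ x) ⟨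
    S + (x + - x)                           ≈⟨ +-assoc S x (- x) ⟨
    (S + x) + - x                           ≈⟨ +-congʳ (+-congˡ (fr-0 x)) ⟨
    (S + fr 0 x) + - x                      ≈⟨ +-congʳ (sumTo-shift n (λ i → fr (2 ℕ.* i) x)) ⟩
    (Tr x + fr (2 ℕ.* n) x) + - x           ≈⟨ +-congʳ (+-congˡ (fr-2n x)) ⟩
    (Tr x + x) + - x                        ≈⟨ +-assoc (Tr x) x (- x) ⟩
    Tr x + (x + - x)                        ≈⟨ +-congˡ (-‿inverseʳ x) ⟩
    Tr x + 0#                               ≈⟨ +-identityʳ (Tr x) ⟩
    Tr x                                    ∎
    where S = sumTo n (λ i → fr (2 ℕ.* suc i) x)

  Tr∈E : ∀ x → mem E (Tr x)
  Tr∈E x = begin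
    Tr x ^ (q ℕ.* q)                            ≈⟨ fr-2 (Tr x) ⟨
    fr 2 (Tr x)                                 ≈⟨ fr-sumTo 2 n _ ⟩
    sumTo n (λ i → fr 2 (fr (2 ℕ.* i) x))       ≈⟨ sumTo-cong n (λ i _ → trans (fr-∘ (2 ℕ.* i) 2 x)
                                                     (fr-index x (≡.trans (ℕₚ.+-comm (2 ℕ.* i) 2) (≡.sym (ℕₚ.*-suc 2 i))))) ⟩
    sumTo n (λ i → fr (2 ℕ.* suc i) x)          ≈⟨ Tr-fr2 x ⟩
    Tr x                                        ∎

  Tr-fr : ∀ k x → Tr (fr (2 ℕ.* k) x) ≈ Tr x
  Tr-fr zero    x = Tr-cong (fr-0 x)
  Tr-fr (suc k) x = begin
    Tr (fr (2 ℕ.* suc k) x)                     ≈⟨ Tr-cong (trans (fr-index x (≡.trans (ℕₚ.*-suc 2 k) (ℕₚ.+-comm 2 (2 ℕ.* k)))) (sym (fr-∘ (2 ℕ.* k) 2 x))) ⟩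
    Tr (fr 2 (fr (2 ℕ.* k) x))                  ≈⟨ sumTo-cong n (λ i _ → trans (fr-∘ 2 (2 ℕ.* i) _) (fr-index _ (≡.sym (ℕₚ.*-suc 2 i)))) ⟩
    sumTo n (λ i → fr (2 ℕ.* suc i) (fr (2 ℕ.* k) x)) ≈⟨ Tr-fr2 (fr (2 ℕ.* k) x) ⟩
    Tr (fr (2 ℕ.* k) x)                         ≈⟨ Tr-fr k x ⟩
    Tr x                                        ∎

  tr : Carrier → Carrier
  tr z = z + z ^ q

  tr-cong : ∀ {x y} → x ≈ y → tr x ≈ tr y
  tr-cong e = +-cong e (^-cong q e)

  tr-+ : ∀ x y → tr (x + y) ≈ tr x + tr y
  tr-+ x y = trans (+-congˡ (^q-+ x y)) (solve 4 (λ a b c d → (a :+ b) :+ (c :+ d) := (a :+ c) :+ (b :+ d)) refl _ _ _ _)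

  tr-0 : tr 0# ≈ 0#
  tr-0 = trans (+-identityˡ _) (0^ q)

  tr∈K : ∀ {z} → mem E z → mem K (tr z)
  tr∈K {z} m = begin
    (z + z ^ q) ^ q          ≈⟨ ^q-+ z (z ^ q) ⟩
    z ^ q + (z ^ q) ^ q      ≈⟨ +-congˡ (trans (^q^q z) m) ⟩
    z ^ q + z                ≈⟨ +-comm _ _ ⟩
    z + z ^ q                ∎

  tr-K-linear : ∀ {k} → mem K k → ∀ z → tr (k * z) ≈ k * tr z
  tr-K-linear {k} m z = trans (+-congˡ (trans (^-distrib-* k z q) (*-congʳ m))) (sym (distribˡ k z (z ^ q)))

  fixed-bound : ∀ d → 1 < d → ∑ (λ x → χ ((x ^ d) ≟ x)) ℤ.≤ + d
  fixed-bound d 1<d = ℤₚ.≤-trans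
    (∑-mono (λ x → χ-mono ((x ^ d) ≟ x) ((- 1# * x ^ 1 + x ^ d) ≟ 0#) (root x)))
    (root-bound (poly-low-+ (poly-< 1<d (poly-* (- 1#) (poly-^ 1))) (poly-^ d)) 1≉0)
    where
    root : ∀ x → x ^ d ≈ x → - 1# * x ^ 1 + x ^ d ≈ 0#
    root x e = begin
      - 1# * x ^ 1 + x ^ d   ≈⟨ +-cong (*-congˡ (^-1 x)) (trans e (sym (*-identityˡ x))) ⟩
      - 1# * x + 1# * x      ≈⟨ distribʳ x (- 1#) 1# ⟨
      (- 1# + 1#) * x        ≈⟨ *-congʳ (-‿inverseˡ 1#) ⟩
      0# * x                 ≈⟨ zeroˡ x ⟩
      0#                     ∎

  poly-Tr : Poly (q ℕ.^ (2 ℕ.* (n ∸ 1))) 1# Tr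
  poly-Tr = go n 1≤n
    where
    go : ∀ k → 1 ≤ k → Poly (q ℕ.^ (2 ℕ.* (k ∸ 1))) 1# (λ x → sumTo k (λ i → fr (2 ℕ.* i) x))
    go (suc k) _ = poly-low-+
      (poly-sumTo k (λ i i<k → poly-< (ℕₚ.^-monoʳ-< q 1<q (ℕₚ.*-monoʳ-< 2 i<k)) (poly-^ (q ℕ.^ (2 ℕ.* i)))))
      (poly-^ (q ℕ.^ (2 ℕ.* k)))

  poly-tr : Poly q 1# tr
  poly-tr = poly-low-+ (poly-< 1<q (poly-cong (λ x → sym (^-1 x)) (poly-^ 1))) (poly-^ q)

  private
    q² = q ℕ.* q

    1<q² : 1 < q²
    1<q² = ℕₚ.<-≤-trans 1<q (ℕₚ.m≤m*n q q)

    q^-pos : ∀ k → 0 < q ℕ.^ k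
    q^-pos k = ℕ.>-nonZero⁻¹ (q ℕ.^ k) {{ℕₚ.m^n≢0 q k}}

    instance
      r-nonZero : ℕ.NonZero r
      r-nonZero = ℕ.>-nonZero 0<r
      Y-nonZero : ℕ.NonZero (q ℕ.^ (2 ℕ.* (n ∸ 1)))
      Y-nonZero = ℕₚ.m^n≢0 q (2 ℕ.* (n ∸ 1))
      1+q-nonZero : ℕ.NonZero (q ℕ.+ 1)
      1+q-nonZero = ℕ.>-nonZero (ℕₚ.m≤n+m 1 q)

  X≡Yq² : q ℕ.^ (2 ℕ.* n) ≡ q ℕ.^ (2 ℕ.* (n ∸ 1)) ℕ.* (q ℕ.* q)
  X≡Yq² = ≡.trans (≡.cong (q ℕ.^_) (go n 1≤n))
    (≡.trans (ℕₚ.^-distribˡ-+-* q (2 ℕ.* (n ∸ 1)) 2) (≡.cong (λ z → q ℕ.^ (2 ℕ.* (n ∸ 1)) ℕ.* (q ℕ.* z)) (ℕₚ.*-identityʳ q)))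
    where
    go : ∀ k → 1 ≤ k → 2 ℕ.* k ≡ 2 ℕ.* (k ∸ 1) ℕ.+ 2
    go (suc k) _ = ≡.trans (ℕₚ.*-suc 2 k) (ℕₚ.+-comm 2 (2 ℕ.* k))

  ∣everything∣ : ∣ everything ∣ₛ ≡ + (q ℕ.^ (2 ℕ.* n))
  ∣everything∣ = ≡.trans ∑-one (≡.cong +_ size≡)

  private
    -- `Tr` has degree q^{2(n-1)} and `E` has at most q² points, while the field has exactly
    -- q^{2(n-1)} q². So `|E| = q²`, and all fibres of `Tr` over `E` have the size of its degree.
    module TrFibres = Equidistribution everything E Tr (λ x _ → Tr∈E x) (q ℕ.^ (2 ℕ.* (n ∸ 1))) q²
      (fixed-bound q² 1<q²)
      (λ s _ → fibre-bound (q^-pos (2 ℕ.* (n ∸ 1))) poly-Tr 1≉0 everything s)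
      (≡.trans ∣everything∣ (≡.cong +_ X≡Yq²))

  ∣E∣ : ∣ E ∣ₛ ≡ + (q ℕ.* q)
  ∣E∣ = TrFibres.target-full

  Tr-fibre : ∀ {s} → mem E s → ∑ (λ x → χ (Tr x ≟ s)) ≡ + (q ℕ.^ (2 ℕ.* (n ∸ 1)))
  Tr-fibre {s} s∈E = ≡.trans (≡.sym (fibre-everything Tr s)) (TrFibres.fibres-full s s∈E)

  private
    -- The same argument one level down: `tr` has degree q, `K` has at most q points, and `|E| = q²`
    -- has just been found.
    module trFibres = Equidistribution E K tr (λ _ → tr∈K) q q
      (fixed-bound q 1<q)
      (λ s _ → fibre-bound (ℕₚ.<-trans (ℕ.s≤s ℕ.z≤n) 1<q) poly-tr 1≉0 E s)
      ∣E∣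

  ∣K∣ : ∣ K ∣ₛ ≡ + q
  ∣K∣ = trFibres.target-full

  tr-fibre : ∀ {s} → mem K s → fibre E tr s ≡ + q
  tr-fibre {s} = trFibres.fibres-full s

  ∣E*∣ : ∣ E* ∣ₛ ≡ + (r ℕ.* (q ℕ.+ 1))
  ∣E*∣ = ≡.trans (∣nonzero∣ E 0∈E) (≡.trans (≡.cong (ℤ._- 1ℤ) (≡.trans ∣E∣ (≡.cong +_ q²≡)))
    (≡.trans (≡.cong (ℤ._- 1ℤ) (ℤₚ.pos-+ (r ℕ.* (q ℕ.+ 1)) 1)) (cancel (+ (r ℕ.* (q ℕ.+ 1))))))
    where
    identity : ∀ r → suc r ℕ.* suc r ≡ r ℕ.* (suc r ℕ.+ 1) ℕ.+ 1
    identity = ℕSolver.solve-∀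
    q²≡ : q ℕ.* q ≡ r ℕ.* (q ℕ.+ 1) ℕ.+ 1
    q²≡ = ≡.subst (λ z → z ℕ.* z ≡ r ℕ.* (z ℕ.+ 1) ℕ.+ 1) (≡.sym q≡1+r) (identity r)
    cancel : ∀ z → (z ℤ.+ 1ℤ) ℤ.- 1ℤ ≡ z
    cancel = solve-∀

  ∣K*∣ : ∣ K* ∣ₛ ≡ + r
  ∣K*∣ = ≡.trans (∣nonzero∣ K 0∈K) (≡.cong (ℤ._- 1ℤ) (≡.trans ∣K∣ (≡.cong +_ q≡1+r)))

  norm∈K* : ∀ {z} → mem E* z → mem K* (z ^ (q ℕ.+ 1))
  norm∈K* {z} (m , z≉0) = fixed , ^-≉0 (q ℕ.+ 1) z≉0
    where
    fixed : (z ^ (q ℕ.+ 1)) ^ q ≈ z ^ (q ℕ.+ 1)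
    fixed = begin
      (z ^ (q ℕ.+ 1)) ^ q         ≈⟨ ^-cong q (trans (^-+ z q 1) (*-congˡ (^-1 z))) ⟩
      (z ^ q * z) ^ q             ≈⟨ ^-distrib-* (z ^ q) z q ⟩
      (z ^ q) ^ q * z ^ q         ≈⟨ *-congʳ (trans (^q^q z) m) ⟩
      z * z ^ q                   ≈⟨ *-comm _ _ ⟩
      z ^ q * z                   ≈⟨ trans (^-+ z q 1) (*-congˡ (^-1 z)) ⟨
      z ^ (q ℕ.+ 1)               ∎

  private
    -- A norm fibre has at most q + 1 points, and (q + 1) r = q² - 1 = `|E*|`; so every element of
    -- `K*` is a norm.
    module NormFibres = Equidistribution E* K* (_^ (q ℕ.+ 1)) (λ _ → norm∈K*) (q ℕ.+ 1) r
      (ℤₚ.≤-reflexive ∣K*∣)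
      (λ s _ → fibre-bound (ℕ.>-nonZero⁻¹ (q ℕ.+ 1)) (poly-^ (q ℕ.+ 1)) 1≉0 E* s)
      (≡.trans ∣E*∣ (≡.cong +_ (ℕₚ.*-comm r (q ℕ.+ 1))))

    +≢0 : ∀ k .{{_ : ℕ.NonZero k}} → ¬ + k ≡ 0ℤ
    +≢0 k e = ℕ.≢-nonZero⁻¹ k (ℤₚ.+-injective e)

  norm-surjective : ∀ {s} → mem K* s → ∃ λ z → mem E* z × z ^ (q ℕ.+ 1) ≈ s
  norm-surjective {s} s∈K* = fibre≢0⇒∃ E* (_^ (q ℕ.+ 1)) (^-cong (q ℕ.+ 1)) s
    (λ e → +≢0 (q ℕ.+ 1) (≡.trans (≡.sym (NormFibres.fibres-full s s∈K*)) e))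

  -- An extra factor z raises the exponent r (q + 1) to q², and the power q² fixes `E`.
  E*-^r∈U : ∀ {z} → mem E* z → mem U (z ^ r)
  E*-^r∈U {z} (m , z≉0) = *-cancelˡ z≉0 (begin
    z * (z ^ r) ^ (q ℕ.+ 1)     ≈⟨ *-congˡ (^-* z r (q ℕ.+ 1)) ⟩
    z ^ suc (r ℕ.* (q ℕ.+ 1))   ≈⟨ ^-exp z exponent ⟩
    z ^ (q ℕ.* q)               ≈⟨ m ⟩
    z                           ≈⟨ *-identityʳ z ⟨
    z * 1#                      ∎)
    where
    identity : ∀ r → suc (r ℕ.* (suc r ℕ.+ 1)) ≡ suc r ℕ.* suc r
    identity = ℕSolver.solve-∀
    exponent : suc (r ℕ.* (q ℕ.+ 1)) ≡ q ℕ.* q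
    exponent = ≡.subst (λ z → suc (r ℕ.* (z ℕ.+ 1)) ≡ z ℕ.* z) (≡.sym q≡1+r) (identity r)

  private
    U-bound : ∣ U ∣ₛ ℤ.≤ + (q ℕ.+ 1)
    U-bound = ≡.subst (ℤ._≤ + (q ℕ.+ 1)) (fibre-everything (_^ (q ℕ.+ 1)) 1#)
      (fibre-bound (ℕ.>-nonZero⁻¹ (q ℕ.+ 1)) (poly-^ (q ℕ.+ 1)) 1≉0 everything 1#)

    module UFibres = Equidistribution E* U (_^ r) (λ _ → E*-^r∈U) r (q ℕ.+ 1)
      U-bound
      (λ s _ → fibre-bound 0<r (poly-^ r) 1≉0 E* s)
      ∣E*∣

  ∣U∣ : ∣ U ∣ₛ ≡ + (q ℕ.+ 1)
  ∣U∣ = UFibres.target-full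

  -- Hilbert 90 for F_{q²}/F_q, by counting. It carries information about the forms `h_t` over to
  -- every υ in `U`.
  hilbert90 : ∀ {υ} → mem U υ → ∃ λ t → mem E* t × t ^ r ≈ υ
  hilbert90 {υ} υ∈U = fibre≢0⇒∃ E* (_^ r) (^-cong r) υ
    (λ e → +≢0 r (≡.trans (≡.sym (UFibres.fibres-full υ υ∈U)) e))

-- The Hermitian forms h_t

module SesquilinearForm (q n : ℕ) (q-pp : IsPrimePower q) (1≤n : 1 ≤ n)
                        (F : FiniteField) (size≡ : FiniteField.size F ≡ q ℕ.^ (2 ℕ.* n))
                        (α : ℕ → FiniteField.Carrier F) where
  open Setting F q n
  open FieldSums F
  open SubsetExistence F
  open FieldPowers F
  open FieldTower q n q-pp 1≤n F size≡
  open SemiringSolver commutativeSemiring using (solve; _:=_; _:+_; _:*_)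
  open SetoidReasoning setoid

  L L* : Carrier → Carrier
  L  = Lpoly α
  L* = Lstar α

  Kυ : Carrier → Carrier → Carrier
  Kυ υ x = υ * L* x + L x

  L-cong : ∀ {x y} → x ≈ y → L x ≈ L y
  L-cong e = sumTo-cong n (λ i _ → *-congˡ (fr-cong (2 ℕ.* i) e))

  L*-cong : ∀ {x y} → x ≈ y → L* x ≈ L* y
  L*-cong e = sumTo-cong n (λ i _ → fr-cong (2 ℕ.* (n ∸ i ∸ 1)) (*-congˡ e))

  Kυ-cong : ∀ {υ υ′ x y} → υ ≈ υ′ → x ≈ y → Kυ υ x ≈ Kυ υ′ y
  Kυ-cong υ≈ e = +-cong (*-cong υ≈ (L*-cong e)) (L-cong e)

  L-+ : ∀ x y → L (x + y) ≈ L x + L y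
  L-+ x y = trans (sumTo-cong n (λ i _ → trans (*-congˡ (fr-+ (2 ℕ.* i) x y)) (distribˡ _ _ _))) (sumTo-+ n _ _)

  L-linear : ∀ {c} → mem E c → ∀ x → L (c * x) ≈ c * L x
  L-linear {c} c∈E x = trans
    (sumTo-cong n (λ i _ → trans (*-congˡ (trans (fr-* (2 ℕ.* i) c x) (*-congʳ (E-fr c∈E i))))
      (solve 3 (λ a c x → a :* (c :* x) := c :* (a :* x)) refl (α i) c (fr (2 ℕ.* i) x))))
    (sumTo-*ˡ n c _)

  Tr-sumTo : ∀ k f → Tr (sumTo k f) ≈ sumTo k (λ i → Tr (f i))
  Tr-sumTo = sumTo-map Tr Tr-0 Tr-+

  Tr-^q : ∀ x → Tr x ^ q ≈ Tr (x ^ q)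
  Tr-^q x = begin
    Tr x ^ q                                ≈⟨ fr-1 (Tr x) ⟨
    fr 1 (Tr x)                             ≈⟨ fr-sumTo 1 n _ ⟩
    sumTo n (λ i → fr 1 (fr (2 ℕ.* i) x))   ≈⟨ sumTo-cong n (λ i _ → trans (fr-∘ (2 ℕ.* i) 1 x)
                                                 (trans (fr-index x (ℕₚ.+-comm (2 ℕ.* i) 1))
                                                 (trans (sym (fr-∘ 1 (2 ℕ.* i) x)) (fr-cong (2 ℕ.* i) (fr-1 x))))) ⟩
    Tr (x ^ q)                              ∎

  B : Carrier → Carrier → Carrier
  B x y = Tr (x * L (y ^ q))

  Q : Carrier → Carrier
  Q x = B x x

  B-cong : ∀ {x x′ y y′} → x ≈ x′ → y ≈ y′ → B x y ≈ B x′ y′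
  B-cong ex ey = Tr-cong (*-cong ex (L-cong (^-cong q ey)))

  B∈E : ∀ x y → mem E (B x y)
  B∈E x y = Tr∈E _

  B-+ˡ : ∀ x y z → B (x + y) z ≈ B x z + B y z
  B-+ˡ x y z = trans (Tr-cong (distribʳ _ x y)) (Tr-+ _ _)

  B-+ʳ : ∀ x y z → B x (y + z) ≈ B x y + B x z
  B-+ʳ x y z = trans (Tr-cong (trans (*-congˡ (trans (L-cong (^q-+ y z)) (L-+ _ _))) (distribˡ x _ _))) (Tr-+ _ _)

  Q-+ : ∀ x y → Q (x + y) ≈ (Q x + Q y) + (B x y + B y x)
  Q-+ x y = trans (B-+ˡ x y (x + y)) (trans (+-cong (B-+ʳ x x y) (B-+ʳ y x y))
    (solve 4 (λ a b c d → (a :+ b) :+ (c :+ d) := (a :+ d) :+ (b :+ c)) refl _ _ _ _))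

  -- The linear argument contributes z, and the semilinear one contributes z^q, which again lies in
  -- `E` and passes through `L`.
  Q-scale : ∀ {z} → mem E z → ∀ x → Q (z * x) ≈ z ^ (q ℕ.+ 1) * Q x
  Q-scale {z} z∈E x = begin
    Tr (z * x * L ((z * x) ^ q))        ≈⟨ Tr-cong (*-congˡ (trans (L-cong (^-distrib-* z x q)) (L-linear zq∈E (x ^ q)))) ⟩
    Tr (z * x * (z ^ q * L (x ^ q)))    ≈⟨ Tr-cong (solve 4 (λ z x w l → z :* x :* (w :* l) := (w :* z) :* (x :* l)) refl z x (z ^ q) _) ⟩
    Tr ((z ^ q * z) * (x * L (x ^ q)))  ≈⟨ Tr-linear (E-* zq∈E z∈E) _ ⟩
    (z ^ q * z) * Q x                   ≈⟨ *-congʳ (trans (^-+ z q 1) (*-congˡ (^-1 z))) ⟨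
    z ^ (q ℕ.+ 1) * Q x                 ∎
    where
    zq∈E : mem E (z ^ q)
    zq∈E = trans (^-* z q (q ℕ.* q)) (trans (^-exp z (ℕₚ.*-comm q (q ℕ.* q)))
             (trans (sym (^-* z (q ℕ.* q) q)) (^-cong q z∈E)))

  -- Both u and u^{q²} are inverse to u^q: the first by hypothesis, the second by the q-th power of
  -- the hypothesis.
  U⊆E : ∀ {u} → mem U u → mem E u
  U⊆E {u} u∈U = *-cancelˡ (^-≉0 q (^≈1⇒≉0 (q ℕ.+ 1) {{ℕ.>-nonZero (ℕₚ.m≤n+m 1 q)}} u∈U)) (begin
    u ^ q * u ^ (q ℕ.* q)     ≈⟨ *-congˡ (^q^q u) ⟨
    u ^ q * (u ^ q) ^ q       ≈⟨ trans (*-comm _ _) (trans (*-congˡ (sym (^-1 _))) (sym (^-+ (u ^ q) q 1))) ⟩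
    (u ^ q) ^ (q ℕ.+ 1)       ≈⟨ trans (^-* u q (q ℕ.+ 1)) (trans (^-exp u (ℕₚ.*-comm q (q ℕ.+ 1))) (sym (^-* u (q ℕ.+ 1) q))) ⟩
    (u ^ (q ℕ.+ 1)) ^ q       ≈⟨ trans (^-cong q u∈U) (1^ q) ⟩
    1#                        ≈⟨ u∈U ⟨
    u ^ (q ℕ.+ 1)             ≈⟨ trans (^-+ u q 1) (*-congˡ (^-1 u)) ⟩
    u ^ q * u                 ∎)

  Q-U : ∀ {u} → mem U u → ∀ x → Q (u * x) ≈ Q x
  Q-U u∈U x = trans (Q-scale (U⊆E u∈U) x) (trans (*-congʳ u∈U) (*-identityˡ _))

  -- `Tr` commutes with the q-th power and is invariant under Frobenius of even index. In term i the
  -- variable y carries index 1 + 2i + 1 after conjugation, and 2(n - i - 1) more steps complete 2n;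
  -- this frees y and explains the exponents of `Lstar`.
  adjoint : ∀ x y → B x y ^ q ≈ Tr (y * L* (x ^ q))
  adjoint x y = begin
    Tr (x * L (y ^ q)) ^ q                          ≈⟨ ^-cong q (Tr-cong (sym (sumTo-*ˡ n x _))) ⟩
    Tr (sumTo n (λ i → x * (α i * fr (2 ℕ.* i) (y ^ q)))) ^ q
                                                    ≈⟨ ^-cong q (Tr-sumTo n _) ⟩
    sumTo n (λ i → Tr (x * (α i * fr (2 ℕ.* i) (y ^ q)))) ^ q
                                                    ≈⟨ sumTo-map (_^ q) (0^ q) ^q-+ n _ ⟩
    sumTo n (λ i → Tr (x * (α i * fr (2 ℕ.* i) (y ^ q))) ^ q)
                                                    ≈⟨ sumTo-cong n term ⟩
    sumTo n (λ i → Tr (y * fr (2 ℕ.* (n ∸ i ∸ 1)) (α i ^ q * x ^ q)))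
                                                    ≈⟨ Tr-sumTo n _ ⟨
    Tr (sumTo n (λ i → y * fr (2 ℕ.* (n ∸ i ∸ 1)) (α i ^ q * x ^ q)))
                                                    ≈⟨ Tr-cong (sumTo-*ˡ n y _) ⟩
    Tr (y * L* (x ^ q))                             ∎
    where
    term : ∀ i → i < n → Tr (x * (α i * fr (2 ℕ.* i) (y ^ q))) ^ q ≈ Tr (y * fr (2 ℕ.* (n ∸ i ∸ 1)) (α i ^ q * x ^ q))
    term i i<n = begin
      Tr (x * (α i * w)) ^ q                          ≈⟨ Tr-^q _ ⟩
      Tr ((x * (α i * w)) ^ q)                        ≈⟨ Tr-fr k _ ⟨
      Tr (fr (2 ℕ.* k) ((x * (α i * w)) ^ q))         ≈⟨ Tr-cong (fr-cong (2 ℕ.* k) (trans (^-distrib-* x _ q) (*-congˡ (^-distrib-* (α i) w q)))) ⟩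
      Tr (fr (2 ℕ.* k) (x ^ q * (α i ^ q * w ^ q)))   ≈⟨ Tr-cong (fr-cong (2 ℕ.* k) (solve 3 (λ a b c → a :* (b :* c) := c :* (b :* a)) refl (x ^ q) (α i ^ q) (w ^ q))) ⟩
      Tr (fr (2 ℕ.* k) (w ^ q * (α i ^ q * x ^ q)))   ≈⟨ Tr-cong (fr-* (2 ℕ.* k) (w ^ q) _) ⟩
      Tr (fr (2 ℕ.* k) (w ^ q) * fr (2 ℕ.* k) (α i ^ q * x ^ q)) ≈⟨ Tr-cong (*-congʳ w-back) ⟩
      Tr (y * fr (2 ℕ.* k) (α i ^ q * x ^ q))         ∎
      where
      k = n ∸ i ∸ 1
      w = fr (2 ℕ.* i) (y ^ q)
      exponent : ((1 ℕ.+ 2 ℕ.* i) ℕ.+ 1) ℕ.+ 2 ℕ.* k ≡ 2 ℕ.* n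
      exponent = ≡.trans (identity i k) (≡.cong (2 ℕ.*_) (≡.trans (≡.cong (λ z → suc i ℕ.+ z) k≡) (ℕₚ.m+[n∸m]≡n i<n)))
        where
        identity : ∀ i k → ((1 ℕ.+ 2 ℕ.* i) ℕ.+ 1) ℕ.+ 2 ℕ.* k ≡ 2 ℕ.* (suc i ℕ.+ k)
        identity = ℕSolver.solve-∀
        k≡ : k ≡ n ∸ suc i
        k≡ = ≡.trans (ℕₚ.∸-+-assoc n i 1) (≡.cong (n ∸_) (ℕₚ.+-comm i 1))
      w-back : fr (2 ℕ.* k) (w ^ q) ≈ y
      w-back = begin
        fr (2 ℕ.* k) (w ^ q)                              ≈⟨ fr-cong (2 ℕ.* k) (fr-1 w) ⟨
        fr (2 ℕ.* k) (fr 1 (fr (2 ℕ.* i) (y ^ q)))        ≈⟨ fr-cong (2 ℕ.* k) (fr-cong 1 (fr-cong (2 ℕ.* i) (fr-1 y))) ⟨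
        fr (2 ℕ.* k) (fr 1 (fr (2 ℕ.* i) (fr 1 y)))       ≈⟨ fr-cong (2 ℕ.* k) (trans (fr-cong 1 (fr-∘ 1 (2 ℕ.* i) y)) (fr-∘ (1 ℕ.+ 2 ℕ.* i) 1 y)) ⟩
        fr (2 ℕ.* k) (fr ((1 ℕ.+ 2 ℕ.* i) ℕ.+ 1) y)       ≈⟨ fr-∘ ((1 ℕ.+ 2 ℕ.* i) ℕ.+ 1) (2 ℕ.* k) y ⟩
        fr (((1 ℕ.+ 2 ℕ.* i) ℕ.+ 1) ℕ.+ 2 ℕ.* k) y        ≈⟨ fr-index y exponent ⟩
        fr (2 ℕ.* n) y                                    ≈⟨ fr-2n y ⟩
        y                                                 ∎

  X Y : ℤ
  X = + (q ℕ.^ (2 ℕ.* n))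
  Y = + (q ℕ.^ (2 ℕ.* (n ∸ 1)))

  qℤ : ℤ
  qℤ = + q

  X≡Yqq : X ≡ Y ℤ.* (qℤ ℤ.* qℤ)
  X≡Yqq = ≡.trans (≡.cong +_ X≡Yq²) (≡.trans (ℤₚ.pos-* (q ℕ.^ (2 ℕ.* (n ∸ 1))) (q ℕ.* q)) (≡.cong (Y ℤ.*_) (ℤₚ.pos-* q q)))

  q≡1+rℤ : qℤ ≡ + r ℤ.+ 1ℤ
  q≡1+rℤ = ≡.trans (≡.cong +_ (≡.trans q≡1+r (≡.sym (ℕₚ.+-comm r 1)))) (ℤₚ.pos-+ r 1)

  ∑1 : ∑ (λ _ → 1ℤ) ≡ X
  ∑1 = ≡.trans ∑-one (≡.cong +_ size≡)

  ∑-scale : ∀ {f} → Ext f → ∀ {w} → ¬ w ≈ 0# → ∑ (λ x → f (x * w)) ≡ ∑ f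
  ∑-scale f-ext {w} w≉0 with inverse w w≉0
  ... | w⁻¹ , ww⁻¹≈1 = ∑-permute f-ext (_* w) (_* w⁻¹) *-congʳ *-congʳ
    (λ x → trans (*-assoc _ _ _) (trans (*-congˡ (trans (*-comm _ _) ww⁻¹≈1)) (*-identityʳ x)))
    (λ x → trans (*-assoc _ _ _) (trans (*-congˡ ww⁻¹≈1) (*-identityʳ x)))

  -- Multiplication by `w` is a bijection, and both traces have fibres of constant size, so each
  -- value is taken X/q times. The factor `qℤ` replaces the division. This is the nondegeneracy of
  -- the trace form in counting form.
  trTr-count : ∀ {w s} → ¬ w ≈ 0# → mem K s → qℤ ℤ.* ∑ (λ y → χ (tr (Tr (y * w)) ≟ s)) ≡ X
  trTr-count {w} {s} w≉0 s∈K = ≡.trans (≡.cong (qℤ ℤ.*_) trTr-fibre) (≡.trans (reorder qℤ Y) (≡.sym X≡Yqq))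
    where
    reorder : ∀ q Y → q ℤ.* (Y ℤ.* q) ≡ Y ℤ.* (q ℤ.* q)
    reorder = solve-∀
    swap : ∀ a b c → a ℤ.* (b ℤ.* c) ≡ b ℤ.* (a ℤ.* c)
    swap = solve-∀
    g : Carrier → ℤ
    g z = χ (tr z ≟ s)
    g-ext : Ext g
    g-ext e = χ≟-cong (tr-cong e) (refl {s})
    trTr-fibre : ∑ (λ y → χ (tr (Tr (y * w)) ≟ s)) ≡ Y ℤ.* qℤ
    trTr-fibre = ≡.trans (∑-scale {λ y → g (Tr y)} (λ e → g-ext (Tr-cong e)) w≉0)
      (≡.trans (∑-cong (λ y → ≡.sym (ℤₚ.*-identityˡ (g (Tr y)))))
      (≡.trans (≡.sym (Fibres.∑-fibres everything E Tr (λ x _ → Tr∈E x) {g} g-ext))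
      (≡.trans (∑-cong (λ z → ≡.trans (χ*-cong (mem? E z) (λ z∈E →
                  ≡.cong (ℤ._* g z) (≡.trans (fibre-everything Tr z) (Tr-fibre z∈E))))
                  (swap (χₛ E z) Y (g z))))
      (≡.trans (∑-*ˡ Y (λ z → χₛ E z ℤ.* g z)) (≡.cong (Y ℤ.*_) (tr-fibre s∈K))))))

  ∑-^q : ∀ {f} → Ext f → ∑ (λ x → f (x ^ q)) ≡ ∑ f
  ∑-^q f-ext = ∑-permute f-ext (_^ q) (fr k) (^-cong q) (fr-cong k)
      (λ x → trans (sym (fr-1 (fr k x))) (trans (fr-∘ k 1 x) (trans (fr-index x (≡.trans (ℕₚ.+-comm k 1) 1+k)) (fr-2n x))))
      (λ x → trans (fr-cong k (sym (fr-1 x))) (trans (fr-∘ 1 k x) (trans (fr-index x 1+k) (fr-2n x))))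
    where
    k = 2 ℕ.* n ∸ 1
    1+k : 1 ℕ.+ k ≡ 2 ℕ.* n
    1+k = ℕₚ.m+[n∸m]≡n (ℕₚ.≤-trans 1≤n (ℕₚ.m≤n*m n 2))

  -- Each fibre of x ↦ x^(q+1) over a nonzero value is empty or a coset of U.
  U-orbits : ∀ {g} → Ext g → (∀ {u} → mem U u → ∀ x → g (u * x) ≡ g x) → + (q ℕ.+ 1) ∣ ∑ g ℤ.- g 0#
  U-orbits {g} g-ext g-inv = ≡.subst (+ (q ℕ.+ 1) ∣_) total (∑-∣ divisible)
    where
    inner : Carrier → ℤ
    inner v = ∑ (λ x → χ ((x ^ (q ℕ.+ 1)) ≟ v) ℤ.* g x)

    instance
      1+q-nonZero : ℕ.NonZero (q ℕ.+ 1)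
      1+q-nonZero = ℕ.>-nonZero (ℕₚ.m≤n+m 1 q)

    total : ∑ (λ v → inner v ℤ.- χ (v ≟ 0#) ℤ.* g 0#) ≡ ∑ g ℤ.- g 0#
    total = ≡.trans (∑-- inner (λ v → χ (v ≟ 0#) ℤ.* g 0#)) (≡.cong₂ ℤ._-_
      (≡.trans (∑-swap (λ v x → χ ((x ^ (q ℕ.+ 1)) ≟ v) ℤ.* g x)) (∑-cong (λ x → ∑-δ {λ _ → g x} (λ _ → ≡.refl) (x ^ (q ℕ.+ 1)))))
      (∑-δ′ {λ _ → g 0#} (λ _ → ≡.refl) 0#))

    divisible : ∀ v → + (q ℕ.+ 1) ∣ inner v ℤ.- χ (v ≟ 0#) ℤ.* g 0#
    divisible v with v ≟ 0#
    -- The fibre over 0 is {0} alone, and its one term is exactly what is subtracted.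
    ... | yes v≈0 = Div.divides 0ℤ (ℤₚ.i≡j⇒i-j≡0 (≡.trans
            (∑-cong (λ x → ≡.cong (ℤ._* g x) (χ-cong ((x ^ (q ℕ.+ 1)) ≟ v) (x ≟ 0#)
              (λ e → ^≈0⇒≈0 (q ℕ.+ 1) (trans e v≈0)) (λ e → trans (trans (^-cong (q ℕ.+ 1) e) (0^ (q ℕ.+ 1))) (sym v≈0)))))
            (≡.trans (∑-δ′ g-ext 0#) (≡.sym (ℤₚ.*-identityˡ (g 0#))))))
    ... | no v≉0 with search (λ x → (x ^ (q ℕ.+ 1)) ≟ v) (λ e m → trans (^-cong (q ℕ.+ 1) (sym e)) m)
    ...   | no none = Div.divides 0ℤ (≡.trans (ℤₚ.+-identityʳ (inner v))
              (≡.trans (∑-cong (λ x → ≡.cong (ℤ._* g x) (χ-no ((x ^ (q ℕ.+ 1)) ≟ v) (λ e → none (x , e))))) ∑-zero))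
    ...   | yes (x₀ , x₀^≈v) = Div.divides (g x₀) (≡.trans (ℤₚ.+-identityʳ (inner v)) (≡.trans coset (ℤₚ.*-comm (+ (q ℕ.+ 1)) (g x₀))))
      where
      x₀≉0 : ¬ x₀ ≈ 0#
      x₀≉0 e = v≉0 (trans (sym x₀^≈v) (trans (^-cong (q ℕ.+ 1) e) (0^ (q ℕ.+ 1))))
      on-coset : ∀ u → χ (((u * x₀) ^ (q ℕ.+ 1)) ≟ v) ℤ.* g (u * x₀) ≡ χₛ U u ℤ.* g x₀
      on-coset u = ≡.trans
        (≡.cong (ℤ._* g (u * x₀)) (χ-cong (((u * x₀) ^ (q ℕ.+ 1)) ≟ v) (mem? U u)
          (λ e → *-cancelˡ v≉0 (trans (*-comm v _) (trans (sym norm) (trans e (sym (*-identityʳ v))))))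
          (λ u∈U → trans norm (trans (*-congʳ u∈U) (*-identityˡ v)))))
        (χ*-cong (mem? U u) (λ u∈U → g-inv u∈U x₀))
        where
        norm : (u * x₀) ^ (q ℕ.+ 1) ≈ u ^ (q ℕ.+ 1) * v
        norm = trans (^-distrib-* u x₀ (q ℕ.+ 1)) (*-congˡ x₀^≈v)
      coset : inner v ≡ + (q ℕ.+ 1) ℤ.* g x₀
      coset = ≡.trans (≡.sym (∑-scale {λ x → χ ((x ^ (q ℕ.+ 1)) ≟ v) ℤ.* g x}
                 (λ e → ≡.cong₂ ℤ._*_ (χ≟-cong (^-cong (q ℕ.+ 1) e) (refl {v})) (g-ext e)) x₀≉0))
              (≡.trans (∑-cong on-coset) (≡.trans (∑-*ʳ (g x₀) (χₛ U)) (≡.cong (ℤ._* g x₀) ∣U∣)))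

  -- A single form `h_t`: distribution of values, Gauss sum and radical

  module HermitianForm {t : Carrier} (t∈E* : mem E* t) where
    t∈E : mem E t
    t∈E = proj₁ t∈E*

    -- Chosen so that t^q = t υ: conjugation then turns the coefficient t of `L` into the
    -- coefficient t υ of `L*`.
    υ : Carrier
    υ = t ^ r

    h : Carrier → Carrier
    h x = tr (t * Q x)

    h-cong : ∀ {x y} → x ≈ y → h x ≈ h y
    h-cong e = tr-cong (*-congˡ (B-cong e e))

    tB∈E : ∀ x y → mem E (t * B x y)
    tB∈E x y = E-* t∈E (B∈E x y)

    h∈K : ∀ x → mem K (h x)
    h∈K x = tr∈K (tB∈E x x)

    -- The polarisation of `h` has the cross terms `t * B y x` and `t * B x y`. The second is
    -- replaced by its conjugate, which has the same `tr` and makes `H x y` linear over `E` in y.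
    H : Carrier → Carrier → Carrier
    H x y = t * B y x + (t * B x y) ^ q

    H-via-K : ∀ x y → H x y ≈ Tr (y * (t * Kυ υ (x ^ q)))
    H-via-K x y = begin
      t * B y x + (t * B x y) ^ q
        ≈⟨ +-congˡ (trans (^-distrib-* t _ q) (*-cong (^-exp t q≡1+r) (adjoint x y))) ⟩
      t * Tr (y * L (x ^ q)) + t * υ * Tr (y * L* (x ^ q))
        ≈⟨ +-cong (Tr-linear t∈E _) (Tr-linear tυ∈E _) ⟨
      Tr (t * (y * L (x ^ q))) + Tr (t * υ * (y * L* (x ^ q)))
        ≈⟨ Tr-+ _ _ ⟨
      Tr (t * (y * L (x ^ q)) + t * υ * (y * L* (x ^ q)))
        ≈⟨ Tr-cong (solve 5 (λ t u y l m → t :* (y :* l) :+ t :* u :* (y :* m) := y :* (t :* (u :* m :+ l))) refl t υ y _ _) ⟩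
      Tr (y * (t * Kυ υ (x ^ q))) ∎
      where
      tυ∈E : mem E (t * υ)
      tυ∈E = E-* t∈E (U⊆E (E*-^r∈U t∈E*))

    h-+ : ∀ x y → h (x + y) ≈ (h x + tr (H x y)) + h y
    h-+ x y = begin
      tr (t * Q (x + y))
        ≈⟨ tr-cong (trans (*-congˡ (Q-+ x y)) (solve 5 (λ t a b c d → t :* ((a :+ b) :+ (c :+ d)) := (t :* a :+ (t :* d :+ t :* c)) :+ t :* b) refl t _ _ _ _)) ⟩
      tr ((t * Q x + (t * B y x + t * B x y)) + t * Q y)
        ≈⟨ trans (tr-+ _ _) (+-congʳ (trans (tr-+ _ _) (+-congˡ (tr-+ _ _)))) ⟩
      (h x + (tr (t * B y x) + tr (t * B x y))) + h y
        ≈⟨ +-congʳ (+-congˡ (trans (+-congˡ (tr-^q (tB∈E x y))) (sym (tr-+ _ _)))) ⟩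
      (h x + tr (H x y)) + h y ∎
      where
      tr-^q : ∀ {z} → mem E z → tr z ≈ tr (z ^ q)
      tr-^q {z} z∈E = trans (+-comm _ _) (+-congˡ (trans (sym z∈E) (sym (^q^q z))))

    -- `h x` unfolds to `H x x`, so no division by 2 occurs and characteristic 2 needs no separate
    -- treatment.
    radical⇒h≈0 : ∀ {x} → Kυ υ (x ^ q) ≈ 0# → h x ≈ 0#
    radical⇒h≈0 {x} Kx≈0 = trans (H-via-K x x) (trans (Tr-cong (trans (*-congˡ (trans (*-congˡ Kx≈0) (zeroʳ t))) (zeroʳ x))) Tr-0)

    h-scale : ∀ {z} → mem E* z → ∀ x → h (z * x) ≈ z ^ (q ℕ.+ 1) * h x
    h-scale {z} z∈E* x = trans (tr-cong (trans (*-congˡ (Q-scale (proj₁ z∈E*) x)) (solve 3 (λ a b c → a :* (b :* c) := b :* (a :* c)) refl t _ _)))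
      (tr-K-linear (proj₁ (norm∈K* z∈E*)) _)

    fib : Carrier → ℤ
    fib s = ∑ (λ x → χ (h x ≟ s))

    -- Every nonzero value of F_q is taken `A` times, and a nontrivial additive character ψ sums to
    -- -1 over F_q^*; hence Σ ψ(h x) = `Z - A`. `R` counts zeros of `Kυ υ` itself, which are as many
    -- as the radical has points because x ↦ x^q is bijective.
    Z A S R : ℤ
    Z = fib 0#
    A = fib 1#
    S = Z ℤ.- A
    R = ∑ (λ x → χ (Kυ υ x ≟ 0#))

    fib-0 : ∀ {s} → s ≈ 0# → fib s ≡ Z
    fib-0 s≈0 = ∑-cong (λ x → χ≟-cong (refl {h x}) s≈0)

    -- For z of norm s, the substitution x ↦ x z multiplies `h` by s and carries the fibre over 1 to
    -- the fibre over s.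
    fib-K* : ∀ {s} → mem K* s → fib s ≡ A
    fib-K* {s} s∈K* with norm-surjective s∈K*
    ... | z , z∈E* , zq+1≈s = ≡.trans (≡.sym (∑-scale {λ x → χ (h x ≟ s)} (λ e → χ≟-cong (h-cong e) (refl {s})) (proj₂ z∈E*)))
      (∑-cong (λ x → χ-cong (h (x * z) ≟ s) (h x ≟ 1#)
        (λ e → *-cancelˡ (proj₂ s∈K*) (trans (sym (scaled x)) (trans e (sym (*-identityʳ s)))))
        (λ e → trans (scaled x) (trans (*-congˡ e) (*-identityʳ s)))))
      where
      scaled : ∀ x → h (x * z) ≈ s * h x
      scaled x = trans (h-cong (*-comm x z)) (trans (h-scale z∈E* x) (*-congʳ zq+1≈s))

    Z+rA≡X : Z ℤ.+ + r ℤ.* A ≡ X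
    Z+rA≡X = ≡.sym (≡.trans (≡.sym ∣everything∣) (≡.trans (≡.sym (Fibres.∑-fibre everything K h (λ x _ → h∈K x)))
      (≡.trans (∑-cong split) (≡.trans (∑-+ (λ s → χ (s ≟ 0#) ℤ.* Z) (λ s → χₛ K* s ℤ.* A))
        (≡.cong₂ ℤ._+_ (∑-δ′ {λ _ → Z} (λ _ → ≡.refl) 0#) (≡.trans (∑-*ʳ A (χₛ K*)) (≡.cong (ℤ._* A) ∣K*∣)))))))
      where
      split : ∀ s → χₛ K s ℤ.* fibre everything h s ≡ χ (s ≟ 0#) ℤ.* Z ℤ.+ χₛ K* s ℤ.* A
      split s = ≡.trans (≡.cong (χₛ K s ℤ.*_) (fibre-everything h s)) (go (s ≟ 0#))
        where
        go : Dec (s ≈ 0#) → χₛ K s ℤ.* fib s ≡ χ (s ≟ 0#) ℤ.* Z ℤ.+ χₛ K* s ℤ.* A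
        go (yes s≈0) = ≡.trans (≡.cong₂ ℤ._*_ (χ-yes (mem? K s) (resp K (sym s≈0) 0∈K)) (fib-0 s≈0))
          (≡.sym (≡.trans (≡.cong₂ (λ a b → a ℤ.* Z ℤ.+ b ℤ.* A) (χ-yes (s ≟ 0#) s≈0) (χ-no (mem? K* s) (λ m → proj₂ m s≈0)))
            (ℤₚ.+-identityʳ (1ℤ ℤ.* Z))))
        go (no s≉0) = ≡.trans (χ*-cong (mem? K s) (λ m → fib-K* (m , s≉0)))
          (≡.sym (≡.trans (≡.cong₂ (λ a b → a ℤ.* Z ℤ.+ b ℤ.* A) (χ-no (s ≟ 0#) s≉0) (χ-cong (mem? K* s) (mem? K s) proj₁ (λ m → m , s≉0)))
            (ℤₚ.+-identityˡ (χₛ K s ℤ.* A))))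

    P : ℤ
    P = ∑ (λ y → ∑ (λ x → χ (h x ≟ h y)))

    P-by-values : P ≡ Z ℤ.* Z ℤ.+ (X ℤ.- Z) ℤ.* A
    P-by-values = ≡.trans (∑-cong split) (≡.trans (∑-+ (λ y → χ (h y ≟ 0#) ℤ.* Z) (λ y → (1ℤ ℤ.- χ (h y ≟ 0#)) ℤ.* A))
      (≡.cong₂ ℤ._+_ (∑-*ʳ Z (λ y → χ (h y ≟ 0#)))
        (≡.trans (∑-*ʳ A (λ y → 1ℤ ℤ.- χ (h y ≟ 0#))) (≡.cong (ℤ._* A)
          (≡.trans (∑-- (λ _ → 1ℤ) (λ y → χ (h y ≟ 0#))) (≡.cong (ℤ._- Z) ∑1))))))
      where
      split : ∀ y → fib (h y) ≡ χ (h y ≟ 0#) ℤ.* Z ℤ.+ (1ℤ ℤ.- χ (h y ≟ 0#)) ℤ.* A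
      split y with h y ≟ 0#
      ... | yes hy≈0 = ≡.trans (fib-0 hy≈0) (≡.sym (≡.trans (ℤₚ.+-identityʳ (1ℤ ℤ.* Z)) (ℤₚ.*-identityˡ Z)))
      ... | no hy≉0  = ≡.trans (fib-K* (h∈K y , hy≉0)) (≡.sym (≡.trans (ℤₚ.+-identityˡ (1ℤ ℤ.* A)) (ℤₚ.*-identityˡ A)))

    R-via-^q : ∑ (λ x → χ (Kυ υ (x ^ q) ≟ 0#)) ≡ R
    R-via-^q = ∑-^q {λ x → χ (Kυ υ x ≟ 0#)} (λ e → χ≟-cong (Kυ-cong (refl {υ}) e) (refl {0#}))

    -- For a fixed difference x the condition on y is `tr (H x y) = - h x`. It holds for all y when
    -- x is in the radical, where `h x` vanishes too, and for X/q values of y otherwise.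
    qP-by-radical : qℤ ℤ.* P ≡ X ℤ.* (+ r ℤ.* R ℤ.+ X)
    qP-by-radical = ≡.trans (≡.cong (qℤ ℤ.*_) differences) (≡.trans (≡.sym (∑-*ˡ qℤ _)) (≡.trans (∑-cong row) (≡.trans
        (∑-*ˡ X (λ x → + r ℤ.* χ (Kυ υ (x ^ q) ≟ 0#) ℤ.+ 1ℤ)) (≡.cong (X ℤ.*_) (≡.trans
          (∑-+ (λ x → + r ℤ.* χ (Kυ υ (x ^ q) ≟ 0#)) (λ _ → 1ℤ)) (≡.cong₂ ℤ._+_
            (≡.trans (∑-*ˡ (+ r) (λ x → χ (Kυ υ (x ^ q) ≟ 0#))) (≡.cong (+ r ℤ.*_) R-via-^q)) ∑1))))))
      where
      differences : P ≡ ∑ (λ x → ∑ (λ y → χ (h (x + y) ≟ h y)))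
      differences = ≡.trans (∑-cong (λ y → ≡.sym (∑-permute {λ x → χ (h x ≟ h y)} (λ e → χ≟-cong (h-cong e) (refl {h y}))
          (_+ y) (_+ (- y)) +-congʳ +-congʳ
          (λ x → trans (+-assoc _ _ _) (trans (+-congˡ (-‿inverseˡ y)) (+-identityʳ x)))
          (λ x → trans (+-assoc _ _ _) (trans (+-congˡ (-‿inverseʳ y)) (+-identityʳ x))))))
        (∑-swap (λ y x → χ (h (x + y) ≟ h y)))

      +-cancelʳ-0 : ∀ {a b} → a + b ≈ b → a ≈ 0#
      +-cancelʳ-0 {a} {b} e = trans (sym (+-identityʳ a)) (trans (+-congˡ (sym (-‿inverseʳ b)))
        (trans (sym (+-assoc a b (- b))) (trans (+-congʳ e) (-‿inverseʳ b))))

      row : ∀ x → qℤ ℤ.* ∑ (λ y → χ (h (x + y) ≟ h y)) ≡ X ℤ.* (+ r ℤ.* χ (Kυ υ (x ^ q) ≟ 0#) ℤ.+ 1ℤ)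
      row x with Kυ υ (x ^ q) ≟ 0#
      ... | yes Kx≈0 = ≡.trans (≡.cong₂ ℤ._*_ q≡1+rℤ (≡.trans (∑-cong (λ y → χ-yes (h (x + y) ≟ h y) (always y))) ∑1)) (reorder (+ r) X)
        where
        reorder : ∀ r X → (r ℤ.+ 1ℤ) ℤ.* X ≡ X ℤ.* (r ℤ.* 1ℤ ℤ.+ 1ℤ)
        reorder = solve-∀
        always : ∀ y → h (x + y) ≈ h y
        always y = trans (h-+ x y) (trans (+-congʳ (trans (+-cong (radical⇒h≈0 Kx≈0)
          (trans (tr-cong (trans (H-via-K x y) (trans (Tr-cong (trans (*-congˡ (trans (*-congˡ Kx≈0) (zeroʳ t))) (zeroʳ y))) Tr-0))) tr-0))
          (+-identityʳ 0#))) (+-identityˡ (h y)))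
      ... | no Kx≉0 = ≡.trans (≡.cong (qℤ ℤ.*_) (∑-cong (λ y → χ-cong (h (x + y) ≟ h y) (tr (Tr (y * (t * Kυ υ (x ^ q)))) ≟ (- h x)) (to y) (from y))))
            (≡.trans (trTr-count (*-≉0 (proj₂ t∈E*) Kx≉0) (K-neg (h∈K x))) (reorder (+ r) X))
        where
        reorder : ∀ r X → X ≡ X ℤ.* (r ℤ.* 0ℤ ℤ.+ 1ℤ)
        reorder = solve-∀
        to : ∀ y → h (x + y) ≈ h y → tr (Tr (y * (t * Kυ υ (x ^ q)))) ≈ - h x
        to y e = trans (tr-cong (sym (H-via-K x y))) (+-inverseʳ-unique _ _ (+-cancelʳ-0 (trans (sym (h-+ x y)) e)))
        from : ∀ y → tr (Tr (y * (t * Kυ υ (x ^ q)))) ≈ - h x → h (x + y) ≈ h y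
        from y e = trans (h-+ x y) (trans (+-congʳ (trans (+-congˡ (trans (tr-cong (H-via-K x y)) e)) (-‿inverseʳ (h x)))) (+-identityˡ (h y)))

    -- With X = Z + rA and q = r + 1 one has r (Z - A)² = q (Z² + r A²) - (Z + rA)² = q P - X², and
    -- the second count of `P` makes this r X R.
    S²≡XR : S ℤ.* S ≡ X ℤ.* R
    S²≡XR = ℤₚ.*-cancelˡ-≡ (+ r) _ _ {{ℤ.≢-nonZero (λ e → ℕₚ.<⇒≢ 0<r (≡.sym (ℤₚ.+-injective e)))}}
      (≡.trans (expand₁ (+ r) Z A) (≡.trans (≡.cong₂ ℤ._-_ left right) (cancel (+ r) X R)))
      where
      expand₁ : ∀ r Z A → r ℤ.* ((Z ℤ.- A) ℤ.* (Z ℤ.- A)) ≡ (r ℤ.+ 1ℤ) ℤ.* (Z ℤ.* Z ℤ.+ (Z ℤ.+ r ℤ.* A ℤ.- Z) ℤ.* A) ℤ.- (Z ℤ.+ r ℤ.* A) ℤ.* (Z ℤ.+ r ℤ.* A)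
      expand₁ = solve-∀
      cancel : ∀ r X R → X ℤ.* (r ℤ.* R ℤ.+ X) ℤ.- X ℤ.* X ≡ r ℤ.* (X ℤ.* R)
      cancel = solve-∀
      left : (+ r ℤ.+ 1ℤ) ℤ.* (Z ℤ.* Z ℤ.+ (Z ℤ.+ + r ℤ.* A ℤ.- Z) ℤ.* A) ≡ X ℤ.* (+ r ℤ.* R ℤ.+ X)
      left = ≡.trans (≡.cong₂ (λ a b → a ℤ.* (Z ℤ.* Z ℤ.+ (b ℤ.- Z) ℤ.* A)) (≡.sym q≡1+rℤ) Z+rA≡X)
        (≡.trans (≡.cong (qℤ ℤ.*_) (≡.sym P-by-values)) qP-by-radical)
      right : (Z ℤ.+ + r ℤ.* A) ℤ.* (Z ℤ.+ + r ℤ.* A) ≡ X ℤ.* X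
      right = ≡.cong₂ ℤ._*_ Z+rA≡X Z+rA≡X

    Q0≈0 : Q 0# ≈ 0#
    Q0≈0 = trans (Tr-cong (zeroˡ _)) Tr-0

    h0≈0 : h 0# ≈ 0#
    h0≈0 = trans (tr-cong (trans (*-congˡ Q0≈0) (zeroʳ t))) tr-0

    q+1∣S-1 : + (q ℕ.+ 1) ∣ S ℤ.- 1ℤ
    q+1∣S-1 = ≡.subst (+ (q ℕ.+ 1) ∣_) (≡.cong₂ ℤ._-_ (∑-- (λ x → χ (h x ≟ 0#)) (λ x → χ (h x ≟ 1#))) g0≡1)
      (U-orbits {g} (λ e → ≡.cong₂ ℤ._-_ (χ≟-cong (h-cong e) (refl {0#})) (χ≟-cong (h-cong e) (refl {1#})))
        (λ u∈U x → ≡.cong₂ ℤ._-_ (χ≟-cong (h-U u∈U x) (refl {0#})) (χ≟-cong (h-U u∈U x) (refl {1#}))))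
      where
      g : Carrier → ℤ
      g x = χ (h x ≟ 0#) ℤ.- χ (h x ≟ 1#)
      h-U : ∀ {u} → mem U u → ∀ x → h (u * x) ≈ h x
      h-U u∈U x = tr-cong (*-congˡ (Q-U u∈U x))
      g0≡1 : g 0# ≡ 1ℤ
      g0≡1 = ≡.cong₂ ℤ._-_ (χ-yes (h 0# ≟ 0#) h0≈0) (χ-no (h 0# ≟ 1#) (λ e → 1≉0 (trans (sym e) h0≈0)))

-- Integer lemmas

∣i∣≤k : ∀ {i k} → i ℤ.≤ + k → ℤ.- i ℤ.≤ + k → ∣ i ∣ ≤ k
∣i∣≤k {i} i≤k -i≤k with ℤₚ.+∣i∣≡i⊎+∣i∣≡-i i
... | inj₁ e = ℤₚ.drop‿+≤+ (≡.subst (λ z → z ℤ.≤ _) (≡.sym e) i≤k)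
... | inj₂ e = ℤₚ.drop‿+≤+ (≡.subst (λ z → z ℤ.≤ _) (≡.sym e) -i≤k)

i≤+∣i∣ : ∀ i → i ℤ.≤ + ∣ i ∣
i≤+∣i∣ (+ n)      = ℤₚ.≤-refl
i≤+∣i∣ ℤ.-[1+ n ] = ℤ.-≤+

-i≤+∣i∣ : ∀ i → ℤ.- i ℤ.≤ + ∣ i ∣
-i≤+∣i∣ i = ≡.subst (λ z → ℤ.- i ℤ.≤ + z) (ℤₚ.∣-i∣≡∣i∣ i) (i≤+∣i∣ (ℤ.- i))

m*m-cancel-≤ : ∀ {m n} → m ℕ.* m ≤ n ℕ.* n → m ≤ n
m*m-cancel-≤ {m} {n} le = ℕₚ.≮⇒≥ (λ n<m → ℕₚ.<⇒≱ (ℕₚ.*-mono-< n<m n<m) le)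

m*m-cancel-≡ : ∀ {m n} → m ℕ.* m ≡ n ℕ.* n → m ≡ n
m*m-cancel-≡ e = ℕₚ.≤-antisym (m*m-cancel-≤ (ℕₚ.≤-reflexive e)) (m*m-cancel-≤ (ℕₚ.≤-reflexive (≡.sym e)))

q+1∣q^k-[-1]^k : ∀ q k → + (q ℕ.+ 1) ∣ + (q ℕ.^ k) ℤ.- -1ℤ ℤ.^ k
q+1∣q^k-[-1]^k q zero    = Div.divides 0ℤ ≡.refl
q+1∣q^k-[-1]^k q (suc k) with q+1∣q^k-[-1]^k q k
-- The new quotient comes from q x + ε = x (q + 1) - (x - ε) with x = q^k, where j is the quotient
-- of x - ε.
... | Div.divides j e = Div.divides (+ (q ℕ.^ k) ℤ.- j) (≡.trans
        (≡.cong (ℤ._- -1ℤ ℤ.* ε) (ℤₚ.pos-* q (q ℕ.^ k)))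
        (≡.trans (expand (+ q) (+ (q ℕ.^ k)) ε) (≡.trans (≡.cong₂ ℤ._-_ (≡.cong (+ (q ℕ.^ k) ℤ.*_) (≡.sym (ℤₚ.pos-+ q 1))) e)
          (factor (+ (q ℕ.^ k)) (+ (q ℕ.+ 1)) j))))
  where
  ε = -1ℤ ℤ.^ k
  expand : ∀ q x ε → q ℤ.* x ℤ.- -1ℤ ℤ.* ε ≡ x ℤ.* (q ℤ.+ 1ℤ) ℤ.- (x ℤ.- ε)
  expand = solve-∀
  factor : ∀ x d j → x ℤ.* d ℤ.- j ℤ.* d ≡ (x ℤ.- j) ℤ.* d
  factor = solve-∀

-1^-cases : ∀ k → (-1ℤ ℤ.^ k ≡ 1ℤ) ⊎ (-1ℤ ℤ.^ k ≡ -1ℤ)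
-1^-cases zero    = inj₁ ≡.refl
-1^-cases (suc k) with -1^-cases k
... | inj₁ e = inj₂ (≡.cong (-1ℤ ℤ.*_) e)
... | inj₂ e = inj₁ (≡.cong (-1ℤ ℤ.*_) e)

-1^2k : ∀ k → -1ℤ ℤ.^ (2 ℕ.* k) ≡ 1ℤ
-1^2k k = ≡.trans (≡.sym (ℤₚ.^-*-assoc -1ℤ 2 k)) (ℤₚ.^-zeroˡ k)

-- With the wrong sign, the two congruences combine to show that d divides 2.
sign-determined : ∀ d → 2 < d → ∀ k {S M} → + d ∣ S ℤ.- 1ℤ → + d ∣ + M ℤ.- -1ℤ ℤ.^ k → ∣ S ∣ ≡ M →
  S ≡ -1ℤ ℤ.^ k ℤ.* + M
sign-determined d 2<d k {S} {M} d∣S-1 d∣M-ε ∣S∣≡M with -1^-cases k | ℤₚ.+∣i∣≡i⊎+∣i∣≡-i S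
... | inj₁ ε≡1 | inj₁ e = ≡.trans (≡.sym e) (≡.trans (≡.cong +_ ∣S∣≡M)
        (≡.sym (≡.trans (≡.cong (ℤ._* + M) ε≡1) (ℤₚ.*-identityˡ (+ M)))))
... | inj₂ ε≡-1 | inj₂ e = ≡.trans (≡.sym (ℤₚ.neg-involutive S)) (≡.trans (≡.cong ℤ.-_ (≡.trans (≡.sym e) (≡.cong +_ ∣S∣≡M)))
        (≡.sym (≡.trans (≡.cong (ℤ._* + M) ε≡-1) (ℤₚ.-1*i≡-i (+ M)))))
... | inj₁ ε≡1 | inj₂ e = contradiction (ℕDiv.∣⇒≤ (Div.∣⇒∣ᵤ 
        (≡.subst (+ d ∣_) (≡.trans (≡.cong₂ (λ a b → (S ℤ.- 1ℤ) ℤ.+ (a ℤ.- b)) (≡.trans (≡.cong +_ (≡.sym ∣S∣≡M)) e) ε≡1) (identity S))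
          (Div.∣m∣n⇒∣m+n d∣S-1 d∣M-ε)))) (ℕₚ.<⇒≱ 2<d)
  where
  identity : ∀ S → (S ℤ.- 1ℤ) ℤ.+ (ℤ.- S ℤ.- 1ℤ) ≡ ℤ.- (+ 2)
  identity = solve-∀
... | inj₂ ε≡-1 | inj₁ e = contradiction (ℕDiv.∣⇒≤ (Div.∣⇒∣ᵤ 
        (≡.subst (+ d ∣_) (≡.trans (≡.cong₂ (λ a b → (S ℤ.- 1ℤ) ℤ.- (a ℤ.- b)) (≡.trans (≡.cong +_ (≡.sym ∣S∣≡M)) e) ε≡-1) (identity S))
          (Div.∣m∣n⇒∣m-n d∣S-1 d∣M-ε)))) (ℕₚ.<⇒≱ 2<d)
  where
  identity : ∀ S → (S ℤ.- 1ℤ) ℤ.- (S ℤ.- -1ℤ) ≡ ℤ.- (+ 2)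
  identity = solve-∀

-- Size of the radicals

module RadicalBound (q n : ℕ) (q-pp : IsPrimePower q) (1≤n : 1 ≤ n)
                    (F : FiniteField) (size≡ : FiniteField.size F ≡ q ℕ.^ (2 ℕ.* n))
                    (α : ℕ → FiniteField.Carrier F) where
  open Setting F q n
  open FieldSums F
  open FieldPowers F
  open Polynomials F
  open FieldTower q n q-pp 1≤n F size≡
  open SesquilinearForm q n q-pp 1≤n F size≡ α
  open SetoidReasoning setoid

  -- After raising to the power q^{2(m+1)} and reducing by x^{q^{2n}} = x, the terms of L* have degree at most q^{2m}.
  radical-bound : ∀ {m} → m < n → ¬ α m ≈ 0# → (∀ i → m < i → α i ≈ 0#) →
    ∀ υ → ∑ (λ x → χ (Kυ υ x ≟ 0#)) ℤ.≤ + (q ℕ.^ (2 ℕ.* (2 ℕ.* m ℕ.+ 1)))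
  radical-bound {m} m<n αm≉0 α-zero υ = ℤₚ.≤-trans
    (∑-mono (λ x → χ-mono (Kυ υ x ≟ 0#) (fr e (Kυ υ x) ≟ 0#) (λ eq → trans (fr-cong e eq) (fr-zero e))))
    (root-bound poly-K (^-≉0 (q ℕ.^ e) αm≉0))
    where
    -- The least shift that takes all exponents of `L*` with i ≤ m past 2n: 2(n - i - 1) + e = 2n +
    -- 2(m - i). The top term of `L` moves to 2m + e = 2(2m + 1), above all the others, with leading
    -- coefficient a Frobenius power of `α m`.
    e = 2 ℕ.* (m ℕ.+ 1)
    D = q ℕ.^ (2 ℕ.* (2 ℕ.* m ℕ.+ 1))

    low : ∀ {k} → k < 2 ℕ.* m ℕ.+ 1 → ∀ c → Poly D 0# (λ x → c * fr (2 ℕ.* k) x)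
    low {k} k< c = poly-< (ℕₚ.^-monoʳ-< q 1<q (ℕₚ.*-monoʳ-< 2 k<)) (poly-* c (poly-^ (q ℕ.^ (2 ℕ.* k))))

    poly-L*-term : ∀ i → i < n → Poly D 0# (λ x → fr e (υ * fr (2 ℕ.* (n ∸ i ∸ 1)) (α i ^ q * x)))
    poly-L*-term i i<n with ℕₚ.<-≤-connex m i
    ... | inj₁ m<i = poly-cong (λ x → trans (fr-cong e (trans (*-congˡ (trans (fr-cong (2 ℕ.* (n ∸ i ∸ 1)) (trans (*-congʳ
                       (trans (^-cong q (α-zero i m<i)) (0^ q))) (zeroˡ x))) (fr-zero (2 ℕ.* (n ∸ i ∸ 1))))) (zeroʳ υ))) (fr-zero e)) (poly-zero D)
    ... | inj₂ i≤m = poly-cong reduce (low (ℕₚ.≤-<-trans (ℕₚ.m∸n≤m m i) m<2m+1) (fr e υ * fr (2 ℕ.* (m ∸ i)) (α i ^ q)))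
      where
      k = n ∸ i ∸ 1
      m<2m+1 : m < 2 ℕ.* m ℕ.+ 1
      m<2m+1 = ≡.subst (m <_) (≡.sym (identity m)) (ℕ.s≤s (ℕₚ.m≤m+n m m))
        where
        identity : ∀ m → 2 ℕ.* m ℕ.+ 1 ≡ suc (m ℕ.+ m)
        identity = ℕSolver.solve-∀
      exponent : 2 ℕ.* k ℕ.+ e ≡ 2 ℕ.* n ℕ.+ 2 ℕ.* (m ∸ i)
      exponent = ≡.trans (≡.sym (ℕₚ.*-distribˡ-+ 2 k (m ℕ.+ 1))) (≡.trans (≡.cong (2 ℕ.*_) (begin-ℕ)) (ℕₚ.*-distribˡ-+ 2 n (m ∸ i)))
        where
        k≡ : k ≡ n ∸ suc i
        k≡ = ≡.trans (ℕₚ.∸-+-assoc n i 1) (≡.cong (n ∸_) (ℕₚ.+-comm i 1))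
        identity : ∀ k i j → k ℕ.+ ((i ℕ.+ j) ℕ.+ 1) ≡ (suc i ℕ.+ k) ℕ.+ j
        identity = ℕSolver.solve-∀
        begin-ℕ : k ℕ.+ (m ℕ.+ 1) ≡ n ℕ.+ (m ∸ i)
        begin-ℕ = ≡.trans (≡.cong (λ z → k ℕ.+ (z ℕ.+ 1)) (≡.sym (ℕₚ.m+[n∸m]≡n i≤m)))
          (≡.trans (identity k i (m ∸ i)) (≡.cong (ℕ._+ (m ∸ i)) (≡.trans (≡.cong (suc i ℕ.+_) k≡) (ℕₚ.m+[n∸m]≡n i<n))))
      reduce : ∀ x → fr e (υ * fr (2 ℕ.* k) (α i ^ q * x)) ≈ fr e υ * fr (2 ℕ.* (m ∸ i)) (α i ^ q) * fr (2 ℕ.* (m ∸ i)) x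
      reduce x = begin
        fr e (υ * fr (2 ℕ.* k) (α i ^ q * x))               ≈⟨ fr-* e υ _ ⟩
        fr e υ * fr e (fr (2 ℕ.* k) (α i ^ q * x))          ≈⟨ *-congˡ (trans (fr-∘ (2 ℕ.* k) e _) (trans (fr-index _ exponent)
                                                                 (trans (sym (fr-∘ (2 ℕ.* n) (2 ℕ.* (m ∸ i)) _)) (fr-cong (2 ℕ.* (m ∸ i)) (fr-2n _))))) ⟩
        fr e υ * fr (2 ℕ.* (m ∸ i)) (α i ^ q * x)           ≈⟨ *-congˡ (fr-* (2 ℕ.* (m ∸ i)) _ x) ⟩
        fr e υ * (fr (2 ℕ.* (m ∸ i)) (α i ^ q) * fr (2 ℕ.* (m ∸ i)) x) ≈⟨ *-assoc _ _ _ ⟨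
        fr e υ * fr (2 ℕ.* (m ∸ i)) (α i ^ q) * fr (2 ℕ.* (m ∸ i)) x   ∎

    reduce-L : ∀ i x → fr e (α i * fr (2 ℕ.* i) x) ≈ fr e (α i) * fr (2 ℕ.* (i ℕ.+ (m ℕ.+ 1))) x
    reduce-L i x = trans (fr-* e (α i) _) (*-congˡ (trans (fr-∘ (2 ℕ.* i) e x) (fr-index x (≡.sym (ℕₚ.*-distribˡ-+ 2 i (m ℕ.+ 1))))))

    top-exponent : ∀ m → m ℕ.+ (m ℕ.+ 1) ≡ 2 ℕ.* m ℕ.+ 1
    top-exponent = ℕSolver.solve-∀

    poly-L-term : ∀ i → ¬ i ≡ m → Poly D 0# (λ x → fr e (α i * fr (2 ℕ.* i) x))
    poly-L-term i i≢m with ℕₚ.<-≤-connex m i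
    ... | inj₁ m<i = poly-cong (λ x → trans (fr-cong e (trans (*-congʳ (α-zero i m<i)) (zeroˡ _))) (fr-zero e)) (poly-zero D)
    ... | inj₂ i≤m = poly-cong (reduce-L i) (low
            (≡.subst (i ℕ.+ (m ℕ.+ 1) <_) (top-exponent m) (ℕₚ.+-monoˡ-< (m ℕ.+ 1) (ℕₚ.≤∧≢⇒< i≤m i≢m))) (fr e (α i)))

    poly-L-top : Poly D (fr e (α m)) (λ x → fr e (α m * fr (2 ℕ.* m) x))
    poly-L-top = poly-coeff (*-identityʳ _) (poly-cong
      (λ x → trans (reduce-L m x) (*-congˡ (fr-index x (≡.cong (2 ℕ.*_) (top-exponent m)))))
      (poly-* (fr e (α m)) (poly-^ D)))

    poly-K : Poly D (fr e (α m)) (λ x → fr e (Kυ υ x))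
    poly-K = poly-cong split (poly-low-+ (poly-sumTo n poly-L*-term) (poly-sumTo-leading n m<n poly-L-term poly-L-top))
      where
      split : ∀ x → fr e (Kυ υ x) ≈ sumTo n (λ i → fr e (υ * fr (2 ℕ.* (n ∸ i ∸ 1)) (α i ^ q * x))) + sumTo n (λ i → fr e (α i * fr (2 ℕ.* i) x))
      split x = trans (fr-+ e _ _) (+-cong (trans (fr-cong e (sym (sumTo-*ˡ n υ _))) (fr-sumTo e n _)) (fr-sumTo e n _))

-- The number of solutions as a sum over t

module Deviation (q n : ℕ) (q-pp : IsPrimePower q) (1≤n : 1 ≤ n)
                 (F : FiniteField) (size≡ : FiniteField.size F ≡ q ℕ.^ (2 ℕ.* n))
                 (α : ℕ → FiniteField.Carrier F) where
  open Setting F q n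
  open FieldSums F
  open SubsetExistence F
  open FieldPowers F
  open FieldTower q n q-pp 1≤n F size≡
  open SesquilinearForm q n q-pp 1≤n F size≡ α

  ∣E*∣ℤ : ∣ E* ∣ₛ ≡ + r ℤ.* (qℤ ℤ.+ 1ℤ)
  ∣E*∣ℤ = ≡.trans ∣E*∣ (≡.trans (ℤₚ.pos-* r (q ℕ.+ 1)) (≡.cong (+ r ℤ.*_) (ℤₚ.pos-+ q 1)))

  -- Scaling by z carries these t to the kernel of `tr` on `E`, which has q elements; t = 0 is then
  -- removed.
  annihilators : ∀ {z} → mem E z → ¬ z ≈ 0# → ∑ (λ t → χₛ E* t ℤ.* χ (tr (t * z) ≟ 0#)) ≡ + r
  annihilators {z} z∈E z≉0 = ≡.trans (∑-cong (λ t → ≡.trans (≡.cong (ℤ._* k t) (χ-nonzero E 0∈E t)) (expand (χₛ E t) (χ (t ≟ 0#)) (k t))))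
    (≡.trans (∑-- (λ t → χₛ E t ℤ.* k t) (λ t → χ (t ≟ 0#) ℤ.* k t))
      (≡.trans (≡.cong₂ ℤ._-_ over-E (≡.trans (∑-δ′ k-ext 0#) (χ-yes (tr (0# * z) ≟ 0#) (trans (tr-cong (zeroˡ z)) tr-0))))
        (≡.trans (≡.cong (ℤ._- 1ℤ) q≡1+rℤ) (cancel (+ r)))))
    where
    k : Carrier → ℤ
    k t = χ (tr (t * z) ≟ 0#)
    k-ext : Ext k
    k-ext e = χ≟-cong (tr-cong (*-congʳ e)) (refl {0#})
    expand : ∀ a b c → (a ℤ.- b) ℤ.* c ≡ a ℤ.* c ℤ.- b ℤ.* c
    expand = solve-∀
    cancel : ∀ r → (r ℤ.+ 1ℤ) ℤ.- 1ℤ ≡ r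
    cancel = solve-∀
    E-cancel : ∀ {t} → mem E (t * z) → mem E t
    E-cancel {t} tz∈E = *-cancelˡ z≉0 (trans (*-congʳ (sym z∈E)) (trans (sym (^-distrib-* z t (q ℕ.* q)))
      (trans (^-cong (q ℕ.* q) (*-comm z t)) (trans tz∈E (*-comm t z)))))
    over-E : ∑ (λ t → χₛ E t ℤ.* k t) ≡ qℤ
    over-E = ≡.trans
      (∑-cong (λ t → ≡.cong (ℤ._* k t) (χ-cong (mem? E t) (mem? E (t * z)) (λ m → E-* m z∈E) E-cancel)))
      (≡.trans (∑-scale {λ t → χₛ E t ℤ.* χ (tr t ≟ 0#)}
                 (λ e → ≡.cong₂ ℤ._*_ (χₛ-ext E e) (χ≟-cong (tr-cong e) (refl {0#}))) z≉0)
               (tr-fibre 0∈K))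

  annihilators-0 : ∀ {z} → z ≈ 0# → ∑ (λ t → χₛ E* t ℤ.* χ (tr (t * z) ≟ 0#)) ≡ + r ℤ.* (qℤ ℤ.+ 1ℤ)
  annihilators-0 {z} z≈0 = ≡.trans (∑-cong (λ t → ≡.trans (≡.cong (χₛ E* t ℤ.*_)
      (χ-yes (tr (t * z) ≟ 0#) (trans (tr-cong (trans (*-congˡ z≈0) (zeroʳ t))) tr-0))) (ℤₚ.*-identityʳ (χₛ E* t)))) ∣E*∣ℤ

  -- Agrees by definition with `S` of `HermitianForm`, but does not depend on a proof of `t ∈ E*`
  -- and can therefore be summed over the whole field.
  gaussSum : Carrier → ℤ
  gaussSum t = ∑ (λ x → χ (tr (t * Q x) ≟ 0#)) ℤ.- ∑ (λ x → χ (tr (t * Q x) ≟ 1#))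

  gaussSum-ext : Ext gaussSum
  gaussSum-ext e = ≡.cong₂ ℤ._-_ (∑-cong (λ x → χ≟-cong (tr-cong (*-congʳ e)) (refl {0#})))
                                 (∑-cong (λ x → χ≟-cong (tr-cong (*-congʳ e)) (refl {1#})))

  module _ (c : Carrier) where
    -- The sum of ψ(utc) over u ∈ F_q^*, for a nontrivial additive character ψ of F_q.
    weight : Carrier → ℤ
    weight t = qℤ ℤ.* χ (tr (t * c) ≟ 0#) ℤ.- 1ℤ

    weight-ext : Ext weight
    weight-ext e = ≡.cong (λ z → qℤ ℤ.* z ℤ.- 1ℤ) (χ≟-cong (tr-cong (*-congʳ e)) (refl {0#}))

    ∣weight∣≤r : ∀ t → ∣ weight t ∣ ≤ r
    ∣weight∣≤r t with tr (t * c) ≟ 0#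
    ... | yes _ = ℕₚ.≤-reflexive (≡.cong ∣_∣ (≡.trans (≡.cong (λ z → z ℤ.* 1ℤ ℤ.- 1ℤ) q≡1+rℤ) (identity (+ r))))
      where
      identity : ∀ r → (r ℤ.+ 1ℤ) ℤ.* 1ℤ ℤ.- 1ℤ ≡ r
      identity = solve-∀
    ... | no _  = ≡.subst (λ z → ∣ z ℤ.- 1ℤ ∣ ≤ r) (≡.sym (ℤₚ.*-zeroʳ qℤ)) 0<r

    ∑-weight : ∀ {J} → ∑ (λ t → χₛ E* t ℤ.* χ (tr (t * c) ≟ 0#)) ≡ J →
      ∑ (λ t → χₛ E* t ℤ.* weight t) ≡ qℤ ℤ.* J ℤ.- + r ℤ.* (qℤ ℤ.+ 1ℤ)
    ∑-weight eq = ≡.trans (∑-cong (λ t → expand (χₛ E* t) qℤ (χ (tr (t * c) ≟ 0#))))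
      (≡.trans (∑-- (λ t → qℤ ℤ.* (χₛ E* t ℤ.* χ (tr (t * c) ≟ 0#))) (χₛ E*))
        (≡.cong₂ ℤ._-_ (≡.trans (∑-*ˡ qℤ (λ t → χₛ E* t ℤ.* χ (tr (t * c) ≟ 0#))) (≡.cong (qℤ ℤ.*_) eq)) ∣E*∣ℤ))
      where
      expand : ∀ e q x → e ℤ.* (q ℤ.* x ℤ.- 1ℤ) ≡ q ℤ.* (e ℤ.* x) ℤ.- e
      expand = solve-∀

    ∑-weight-0 : c ≈ 0# → ∑ (λ t → χₛ E* t ℤ.* weight t) ≡ + r ℤ.* (qℤ ℤ.+ 1ℤ) ℤ.* + r
    ∑-weight-0 c≈0 = ≡.trans (∑-weight (annihilators-0 c≈0))
      (≡.trans (≡.cong (λ z → z ℤ.* (+ r ℤ.* (z ℤ.+ 1ℤ)) ℤ.- + r ℤ.* (z ℤ.+ 1ℤ)) q≡1+rℤ)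
        (≡.trans (identity (+ r)) (≡.cong (λ z → + r ℤ.* (z ℤ.+ 1ℤ) ℤ.* + r) (≡.sym q≡1+rℤ))))
      where
      identity : ∀ r → (r ℤ.+ 1ℤ) ℤ.* (r ℤ.* (r ℤ.+ 1ℤ ℤ.+ 1ℤ)) ℤ.- r ℤ.* (r ℤ.+ 1ℤ ℤ.+ 1ℤ) ≡ r ℤ.* (r ℤ.+ 1ℤ ℤ.+ 1ℤ) ℤ.* r
      identity = solve-∀

  module _ {c : Carrier} (c∈E : mem E c) where
    -- Positive and negative weights nearly cancel here, whereas at c = 0 all of them equal r. This
    -- contrast excludes c ≠ 0 from the case of equality.
    ∑-weight-≉0 : ¬ c ≈ 0# → ∑ (λ t → χₛ E* t ℤ.* weight c t) ≡ ℤ.- + r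
    ∑-weight-≉0 c≉0 = ≡.trans (∑-weight c (annihilators c∈E c≉0)) (identity qℤ (+ r))
      where
      identity : ∀ q r → q ℤ.* r ℤ.- r ℤ.* (q ℤ.+ 1ℤ) ≡ ℤ.- r
      identity = solve-∀

    solutions : ℤ
    solutions = ∑ (λ x → χ ((Q x + c) ≟ 0#))

    private
      row : Carrier → ℤ
      row t = ∑ (λ x → χ (tr (t * (Q x + c)) ≟ 0#))

      -- The condition on x is `h x = - tr (t * c)`, so the row is `Z` or `A`. With X = Z + rA these
      -- satisfy q Z = X + r S and q A = X - S, and r and -1 are the two values of `weight`.
      q-row : ∀ {t} → mem E* t → qℤ ℤ.* row t ≡ X ℤ.+ gaussSum t ℤ.* weight c t
      q-row {t} t∈E* = ≡.trans (≡.cong (qℤ ℤ.*_) (∑-cong (λ x → χ-cong (tr (t * (Q x + c)) ≟ 0#) (h x ≟ (- tr (t * c)))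
            (λ e → uniq (trans (sym (split x)) e)) (λ e → trans (split x) (trans (+-congʳ e) (-‿inverseˡ _)))))) (by-cases (tr (t * c) ≟ 0#))
        where
        open HermitianForm t∈E*
        split : ∀ x → tr (t * (Q x + c)) ≈ h x + tr (t * c)
        split x = trans (tr-cong (distribˡ t (Q x) c)) (tr-+ _ _)
        uniq : ∀ {a b} → a + b ≈ 0# → a ≈ - b
        uniq e = +-inverseʳ-unique _ _ (trans (+-comm _ _) e)
        tc∈K : mem K (tr (t * c))
        tc∈K = tr∈K (E-* t∈E c∈E)
        identity₁ : ∀ r Z A → (r ℤ.+ 1ℤ) ℤ.* Z ≡ (Z ℤ.+ r ℤ.* A) ℤ.+ (Z ℤ.- A) ℤ.* ((r ℤ.+ 1ℤ) ℤ.* 1ℤ ℤ.- 1ℤ)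
        identity₁ = solve-∀
        identity₂ : ∀ r Z A → (r ℤ.+ 1ℤ) ℤ.* A ≡ (Z ℤ.+ r ℤ.* A) ℤ.+ (Z ℤ.- A) ℤ.* ((r ℤ.+ 1ℤ) ℤ.* 0ℤ ℤ.- 1ℤ)
        identity₂ = solve-∀
        by-cases : Dec (tr (t * c) ≈ 0#) → qℤ ℤ.* fib (- tr (t * c)) ≡ X ℤ.+ S ℤ.* weight c t
        by-cases (yes tc≈0) = ≡.trans (≡.cong (qℤ ℤ.*_) (fib-0 (trans (-‿cong tc≈0) -0#≈0#)))
          (≡.trans (≡.cong (ℤ._* Z) q≡1+rℤ) (≡.trans (identity₁ (+ r) Z A)
            (≡.cong₂ (λ a b → a ℤ.+ S ℤ.* b) Z+rA≡X
              (≡.cong₂ (λ a b → a ℤ.* b ℤ.- 1ℤ) (≡.sym q≡1+rℤ) (≡.sym (χ-yes (tr (t * c) ≟ 0#) tc≈0))))))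
        by-cases (no tc≉0) = ≡.trans (≡.cong (qℤ ℤ.*_) (fib-K* (K-neg tc∈K , (λ e → tc≉0 (trans (sym (-‿involutive _)) (trans (-‿cong e) -0#≈0#))))))
          (≡.trans (≡.cong (ℤ._* A) q≡1+rℤ) (≡.trans (identity₂ (+ r) Z A)
            (≡.cong₂ (λ a b → a ℤ.+ S ℤ.* b) Z+rA≡X
              (≡.cong₂ (λ a b → a ℤ.* b ℤ.- 1ℤ) (≡.sym q≡1+rℤ) (≡.sym (χ-no (tr (t * c) ≟ 0#) tc≉0))))))

      -- A solution x is annihilated by all r (q + 1) = r q + r elements of `E*`, any other x by r
      -- of them.
      column : ∀ x → ∑ (λ t → χₛ E* t ℤ.* χ (tr (t * (Q x + c)) ≟ 0#)) ≡ + r ℤ.* qℤ ℤ.* χ ((Q x + c) ≟ 0#) ℤ.+ + r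
      column x with (Q x + c) ≟ 0#
      ... | yes eq = ≡.trans (annihilators-0 eq) (identity (+ r) qℤ)
        where
        identity : ∀ r q → r ℤ.* (q ℤ.+ 1ℤ) ≡ r ℤ.* q ℤ.* 1ℤ ℤ.+ r
        identity = solve-∀
      ... | no neq = ≡.trans (annihilators (E-+ (B∈E x x) c∈E) neq) (identity (+ r) qℤ)
        where
        identity : ∀ r q → r ≡ r ℤ.* q ℤ.* 0ℤ ℤ.+ r
        identity = solve-∀

      double-count : ∑ (λ t → χₛ E* t ℤ.* row t) ≡ + r ℤ.* qℤ ℤ.* solutions ℤ.+ + r ℤ.* X
      double-count = ≡.trans (∑-cong (λ t → ≡.sym (∑-*ˡ (χₛ E* t) (λ x → χ (tr (t * (Q x + c)) ≟ 0#)))))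
        (≡.trans (∑-swap (λ t x → χₛ E* t ℤ.* χ (tr (t * (Q x + c)) ≟ 0#))) (≡.trans (∑-cong column)
          (≡.trans (∑-+ (λ x → + r ℤ.* qℤ ℤ.* χ ((Q x + c) ≟ 0#)) (λ _ → + r))
            (≡.cong₂ ℤ._+_ (∑-*ˡ (+ r ℤ.* qℤ) (λ x → χ ((Q x + c) ≟ 0#)))
              (≡.trans (∑-const (+ r)) (≡.trans (≡.cong (λ z → + z ℤ.* + r) size≡) (ℤₚ.*-comm X (+ r))))))))

    -- Equating q times the column count r q N + r X with the sum of the rows gives r q² N + r q X =
    -- r (q + 1) X + Σ S w. What is left of the main terms is r X = r q² Y.
    deviation : + r ℤ.* (qℤ ℤ.* qℤ) ℤ.* (solutions ℤ.- Y) ≡ ∑ (λ t → χₛ E* t ℤ.* (gaussSum t ℤ.* weight c t))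
    deviation = ≡.trans (rearrange (+ r) qℤ solutions Y) (≡.trans (≡.cong₂ ℤ._-_ total (≡.cong (+ r ℤ.* (qℤ ℤ.+ 1ℤ) ℤ.*_) (≡.sym X≡Yqq))) (cancel (+ r ℤ.* (qℤ ℤ.+ 1ℤ) ℤ.* X) Σw))
      where
      Σw = ∑ (λ t → χₛ E* t ℤ.* (gaussSum t ℤ.* weight c t))
      rearrange : ∀ r q N Y → r ℤ.* (q ℤ.* q) ℤ.* (N ℤ.- Y) ≡ q ℤ.* (r ℤ.* q ℤ.* N ℤ.+ r ℤ.* (Y ℤ.* (q ℤ.* q))) ℤ.- r ℤ.* (q ℤ.+ 1ℤ) ℤ.* (Y ℤ.* (q ℤ.* q))
      rearrange = solve-∀
      cancel : ∀ a b → (a ℤ.+ b) ℤ.- a ≡ b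
      cancel = solve-∀
      shuffle : ∀ q e a → q ℤ.* (e ℤ.* a) ≡ e ℤ.* (q ℤ.* a)
      shuffle = solve-∀
      total : qℤ ℤ.* (+ r ℤ.* qℤ ℤ.* solutions ℤ.+ + r ℤ.* (Y ℤ.* (qℤ ℤ.* qℤ))) ≡ + r ℤ.* (qℤ ℤ.+ 1ℤ) ℤ.* X ℤ.+ Σw
      total = ≡.trans (≡.cong (λ z → qℤ ℤ.* (+ r ℤ.* qℤ ℤ.* solutions ℤ.+ + r ℤ.* z)) (≡.sym X≡Yqq))
        (≡.trans (≡.cong (qℤ ℤ.*_) (≡.sym double-count)) (≡.trans (≡.sym (∑-*ˡ qℤ (λ t → χₛ E* t ℤ.* row t)))
        (≡.trans (∑-cong (λ t → ≡.trans (shuffle qℤ (χₛ E* t) (row t)) (≡.trans (χ*-cong (mem? E* t) q-row)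
                  (ℤₚ.*-distribˡ-+ (χₛ E* t) X (gaussSum t ℤ.* weight c t)))))
        (≡.trans (∑-+ (λ t → χₛ E* t ℤ.* X) (λ t → χₛ E* t ℤ.* (gaussSum t ℤ.* weight c t)))
          (≡.cong (ℤ._+ Σw) (≡.trans (∑-*ʳ X (χₛ E*)) (≡.cong (ℤ._* X) ∣E*∣ℤ)))))))

-- The bound, the case of equality and the sign

module Conclusion (q n : ℕ) (q-pp : IsPrimePower q) (1≤n : 1 ≤ n)
                  (F : FiniteField) (size≡ : FiniteField.size F ≡ q ℕ.^ (2 ℕ.* n))
                  (m : ℕ) (m<n : m < n) (α : ℕ → FiniteField.Carrier F)
                  (αm≉0 : ¬ FiniteField._≈_ F (α m) (FiniteField.0# F))
                  (α-zero : ∀ i → m < i → FiniteField._≈_ F (α i) (FiniteField.0# F)) where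
  open Setting F q n
  open FieldSums F
  open FieldPowers F
  open FieldTower q n q-pp 1≤n F size≡
  open SesquilinearForm q n q-pp 1≤n F size≡ α
  open RadicalBound q n q-pp 1≤n F size≡ α
  open Deviation q n q-pp 1≤n F size≡ α

  -- `D` is the largest possible radical and `M`, the square root of X D, the largest possible
  -- |S_t|. The exponent n + 2m + 1 of `M` is written as that of `bound` plus 2.
  D M bound : ℕ
  D = q ℕ.^ (2 ℕ.* (2 ℕ.* m ℕ.+ 1))
  M = q ℕ.^ (n ∸ 1 ℕ.+ 2 ℕ.* m ℕ.+ 2)
  bound = (q ℕ.* q ∸ 1) ℕ.* q ℕ.^ (n ∸ 1 ℕ.+ 2 ℕ.* m)

  dev : Carrier → ℤ
  dev c = + N α c ℤ.- Y

  kerCond : Set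
  kerCond = ∀ υ → InU υ → DimKer (λ x → υ * Lstar α x + Lpoly α x) (2 ℕ.* m ℕ.+ 1)

  private instance
    r-nonZero : ℕ.NonZero r
    r-nonZero = ℕ.>-nonZero 0<r
    X-nonZero : ℕ.NonZero (q ℕ.^ (2 ℕ.* n))
    X-nonZero = ℕₚ.m^n≢0 q (2 ℕ.* n)
    M-nonZero : ℕ.NonZero M
    M-nonZero = ℕₚ.m^n≢0 q (n ∸ 1 ℕ.+ 2 ℕ.* m ℕ.+ 2)
    rqq-nonZero : ℕ.NonZero (r ℕ.* (q ℕ.* q))
    rqq-nonZero = ℕₚ.m*n≢0 r (q ℕ.* q) {{r-nonZero}} {{ℕₚ.m*n≢0 q q}}

  M*M≡XD : M ℕ.* M ≡ q ℕ.^ (2 ℕ.* n) ℕ.* D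
  M*M≡XD = ≡.trans (≡.sym (ℕₚ.^-distribˡ-+-* q e e)) (≡.trans (≡.cong (q ℕ.^_) exponent) (ℕₚ.^-distribˡ-+-* q (2 ℕ.* n) (2 ℕ.* (2 ℕ.* m ℕ.+ 1))))
    where
    e = n ∸ 1 ℕ.+ 2 ℕ.* m ℕ.+ 2
    identity : ∀ k m → (k ℕ.+ 2 ℕ.* m ℕ.+ 2) ℕ.+ (k ℕ.+ 2 ℕ.* m ℕ.+ 2) ≡ 2 ℕ.* (1 ℕ.+ k) ℕ.+ 2 ℕ.* (2 ℕ.* m ℕ.+ 1)
    identity = ℕSolver.solve-∀
    exponent : (n ∸ 1 ℕ.+ 2 ℕ.* m ℕ.+ 2) ℕ.+ (n ∸ 1 ℕ.+ 2 ℕ.* m ℕ.+ 2) ≡ 2 ℕ.* n ℕ.+ 2 ℕ.* (2 ℕ.* m ℕ.+ 1)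
    exponent = ≡.trans (identity (n ∸ 1) m) (≡.cong (λ z → 2 ℕ.* z ℕ.+ 2 ℕ.* (2 ℕ.* m ℕ.+ 1)) (ℕₚ.m+[n∸m]≡n 1≤n))

  D≡[q²]^ : D ≡ (q ℕ.* q) ℕ.^ (2 ℕ.* m ℕ.+ 1)
  D≡[q²]^ = ≡.trans (≡.sym (ℕₚ.^-*-assoc q 2 (2 ℕ.* m ℕ.+ 1))) (≡.cong (λ z → (q ℕ.* z) ℕ.^ (2 ℕ.* m ℕ.+ 1)) (ℕₚ.*-identityʳ q))

  -- The right side is the number of t times the largest term; the factor r q² on the left is the
  -- scale of `deviation`.
  rqq*bound : r ℕ.* (q ℕ.* q) ℕ.* bound ≡ r ℕ.* (q ℕ.+ 1) ℕ.* (M ℕ.* r)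
  rqq*bound = ≡.trans (≡.cong (λ z → r ℕ.* (q ℕ.* q) ℕ.* (z ℕ.* B₀)) q²-1)
    (≡.trans (identity r q B₀) (≡.cong (λ z → r ℕ.* (q ℕ.+ 1) ℕ.* (z ℕ.* r)) (≡.sym M≡)))
    where
    B₀ = q ℕ.^ (n ∸ 1 ℕ.+ 2 ℕ.* m)
    identity : ∀ r q B → r ℕ.* (q ℕ.* q) ℕ.* (r ℕ.* (q ℕ.+ 1) ℕ.* B) ≡ r ℕ.* (q ℕ.+ 1) ℕ.* (B ℕ.* (q ℕ.* q) ℕ.* r)
    identity = ℕSolver.solve-∀
    M≡ : M ≡ B₀ ℕ.* (q ℕ.* q)
    M≡ = ≡.trans (ℕₚ.^-distribˡ-+-* q (n ∸ 1 ℕ.+ 2 ℕ.* m) 2) (≡.cong (λ z → B₀ ℕ.* (q ℕ.* z)) (ℕₚ.*-identityʳ q))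
    square : ∀ r → suc r ℕ.* suc r ≡ suc (r ℕ.* (suc r ℕ.+ 1))
    square = ℕSolver.solve-∀
    q²-1 : q ℕ.* q ∸ 1 ≡ r ℕ.* (q ℕ.+ 1)
    q²-1 = ≡.cong (_∸ 1) (≡.subst (λ z → z ℕ.* z ≡ suc (r ℕ.* (z ℕ.+ 1))) (≡.sym q≡1+r) (square r))

  radicalSize : Carrier → ℕ
  radicalSize t = zeroCount (Kυ (t ^ r))

  ∣gaussSum∣² : ∀ {t} → mem E* t → ∣ gaussSum t ∣ ℕ.* ∣ gaussSum t ∣ ≡ q ℕ.^ (2 ℕ.* n) ℕ.* radicalSize t
  ∣gaussSum∣² {t} t∈E* = ≡.trans (≡.sym (ℤₚ.abs-* (gaussSum t) (gaussSum t)))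
    (≡.cong ∣_∣ (≡.trans S²≡XR (≡.trans (≡.cong (X ℤ.*_) (≡.sym (+zeroCount (Kυ (t ^ r))))) (≡.sym (ℤₚ.pos-* (q ℕ.^ (2 ℕ.* n)) (radicalSize t))))))
    where open HermitianForm t∈E*

  radicalSize≤D : ∀ t → radicalSize t ≤ D
  radicalSize≤D t = ℤₚ.drop‿+≤+ (≡.subst (ℤ._≤ + D) (≡.sym (+zeroCount (Kυ (t ^ r)))) (radical-bound m<n αm≉0 α-zero (t ^ r)))

  ∣gaussSum∣≤M : ∀ {t} → mem E* t → ∣ gaussSum t ∣ ≤ M
  ∣gaussSum∣≤M {t} t∈E* = m*m-cancel-≤ (≡.subst₂ _≤_ (≡.sym (∣gaussSum∣² t∈E*)) (≡.sym M*M≡XD)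
    (ℕₚ.*-monoʳ-≤ (q ℕ.^ (2 ℕ.* n)) (radicalSize≤D t)))

  kerCond⇒∣gaussSum∣≡M : kerCond → ∀ {t} → mem E* t → ∣ gaussSum t ∣ ≡ M
  kerCond⇒∣gaussSum∣≡M ker {t} t∈E* = m*m-cancel-≡ (≡.trans (∣gaussSum∣² t∈E*)
    (≡.trans (≡.cong (q ℕ.^ (2 ℕ.* n) ℕ.*_) (≡.trans (ker (t ^ r) (E*-^r∈U t∈E*)) (≡.sym D≡[q²]^))) (≡.sym M*M≡XD)))

  -- The Gauss sums only see υ of the form t^r; by `hilbert90` these are all of `U`.
  ∣gaussSum∣≡M⇒kerCond : (∀ {t} → mem E* t → ∣ gaussSum t ∣ ≡ M) → kerCond
  ∣gaussSum∣≡M⇒kerCond eq υ υ∈U with hilbert90 υ∈U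
  ... | t , t∈E* , tʳ≈υ = ≡.trans
    (ℤₚ.+-injective (≡.trans (+zeroCount (Kυ υ)) (≡.trans
      (∑-cong (λ x → χ≟-cong (Kυ-cong (sym tʳ≈υ) (refl {x})) (refl {0#}))) (≡.sym (+zeroCount (Kυ (t ^ r)))))))
    (≡.trans (ℕₚ.*-cancelˡ-≡ (radicalSize t) D (q ℕ.^ (2 ℕ.* n))
      (≡.trans (≡.sym (∣gaussSum∣² t∈E*)) (≡.trans (≡.cong₂ ℕ._*_ (eq t∈E*) (eq t∈E*)) M*M≡XD))) D≡[q²]^)

  ε : ℤ
  ε = -1ℤ ℤ.^ (n ∸ 1)

  kerCond⇒gaussSum : kerCond → ∀ {t} → mem E* t → gaussSum t ≡ ε ℤ.* + M
  kerCond⇒gaussSum ker {t} t∈E* = ≡.trans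
      (sign-determined (q ℕ.+ 1) (ℕₚ.+-monoˡ-< 1 1<q) (n ∸ 1 ℕ.+ 2 ℕ.* m ℕ.+ 2) (HermitianForm.q+1∣S-1 t∈E*) (q+1∣q^k-[-1]^k q (n ∸ 1 ℕ.+ 2 ℕ.* m ℕ.+ 2)) (kerCond⇒∣gaussSum∣≡M ker t∈E*))
      (≡.cong (ℤ._* + M) sign≡)
    where
    -- The exponent of `M` exceeds n - 1 by the even number 2m + 2.
    sign≡ : -1ℤ ℤ.^ (n ∸ 1 ℕ.+ 2 ℕ.* m ℕ.+ 2) ≡ ε
    sign≡ = ≡.trans (ℤₚ.^-distribˡ-+-* -1ℤ (n ∸ 1 ℕ.+ 2 ℕ.* m) 2) (≡.trans (ℤₚ.*-identityʳ _)
      (≡.trans (ℤₚ.^-distribˡ-+-* -1ℤ (n ∸ 1) (2 ℕ.* m)) (≡.trans (≡.cong (ε ℤ.*_) (-1^2k m)) (ℤₚ.*-identityʳ ε))))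

  rqqℤ : + r ℤ.* (qℤ ℤ.* qℤ) ≡ + (r ℕ.* (q ℕ.* q))
  rqqℤ = ≡.trans (≡.cong (+ r ℤ.*_) (≡.sym (ℤₚ.pos-* q q))) (≡.sym (ℤₚ.pos-* r (q ℕ.* q)))

  module _ {c : Carrier} (c∈E : mem E c) where
    term : Carrier → ℤ
    term t = gaussSum t ℤ.* weight c t

    term-ext : Ext term
    term-ext e = ≡.cong₂ ℤ._*_ (gaussSum-ext e) (weight-ext c e)

    total : ℤ
    total = ∑ (λ t → χₛ E* t ℤ.* term t)

    scaled-dev : + (r ℕ.* (q ℕ.* q)) ℤ.* dev c ≡ total
    scaled-dev = ≡.trans (≡.cong₂ ℤ._*_ (≡.sym rqqℤ) (≡.cong (ℤ._- Y) (+zeroCount _))) (deviation c∈E)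

    ∣scaled-dev∣ : r ℕ.* (q ℕ.* q) ℕ.* ∣ dev c ∣ ≡ ∣ total ∣
    ∣scaled-dev∣ = ≡.trans (≡.sym (ℤₚ.abs-* (+ (r ℕ.* (q ℕ.* q))) (dev c))) (≡.cong ∣_∣ scaled-dev)

    ∣term∣≤ : ∀ {t} → mem E* t → ∣ term t ∣ ≤ M ℕ.* r
    ∣term∣≤ {t} t∈E* = ≡.subst (_≤ M ℕ.* r) (≡.sym (ℤₚ.abs-* (gaussSum t) (weight c t)))
      (ℕₚ.*-mono-≤ (∣gaussSum∣≤M t∈E*) (∣weight∣≤r c t))

    ∣E*∣*Mr : ∑ (λ t → χₛ E* t ℤ.* + (M ℕ.* r)) ≡ + (r ℕ.* (q ℕ.+ 1) ℕ.* (M ℕ.* r))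
    ∣E*∣*Mr = ≡.trans (∑-*ʳ (+ (M ℕ.* r)) (χₛ E*)) (≡.trans (≡.cong (ℤ._* + (M ℕ.* r)) ∣E*∣) (≡.sym (ℤₚ.pos-* (r ℕ.* (q ℕ.+ 1)) (M ℕ.* r))))

    -total : ∑ (λ t → χₛ E* t ℤ.* ℤ.- term t) ≡ ℤ.- total
    -total = ≡.trans (∑-cong (λ t → negate (χₛ E* t) (term t))) (≡.trans (∑-*ˡ -1ℤ (λ t → χₛ E* t ℤ.* term t)) (ℤₚ.-1*i≡-i total))
      where
      negate : ∀ a b → a ℤ.* ℤ.- b ≡ -1ℤ ℤ.* (a ℤ.* b)
      negate = solve-∀

    term-≤ : ∀ t → χₛ E* t ℤ.* term t ℤ.≤ χₛ E* t ℤ.* + (M ℕ.* r)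
    term-≤ t = χ*-mono (mem? E* t) (λ t∈E* → ℤₚ.≤-trans (i≤+∣i∣ (term t)) (ℤ.+≤+ (∣term∣≤ t∈E*)))

    -term-≤ : ∀ t → χₛ E* t ℤ.* ℤ.- term t ℤ.≤ χₛ E* t ℤ.* + (M ℕ.* r)
    -term-≤ t = χ*-mono (mem? E* t) (λ t∈E* → ℤₚ.≤-trans (-i≤+∣i∣ (term t)) (ℤ.+≤+ (∣term∣≤ t∈E*)))

    ∣dev∣≤bound : ∣ dev c ∣ ≤ bound
    ∣dev∣≤bound = ℕₚ.*-cancelˡ-≤ (r ℕ.* (q ℕ.* q)) (≡.subst₂ _≤_ (≡.sym ∣scaled-dev∣) (≡.sym rqq*bound)
      (∣i∣≤k (≡.subst (total ℤ.≤_) ∣E*∣*Mr (∑-mono term-≤))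
             (≡.subst₂ ℤ._≤_ -total ∣E*∣*Mr (∑-mono -term-≤))))

    squeeze : ∀ {f} → Ext f → (∀ t → χₛ E* t ℤ.* f t ℤ.≤ χₛ E* t ℤ.* + (M ℕ.* r)) →
      ∑ (λ t → χₛ E* t ℤ.* f t) ≡ + (r ℕ.* (q ℕ.+ 1) ℕ.* (M ℕ.* r)) → ∀ {t} → mem E* t → f t ≡ + (M ℕ.* r)
    squeeze {f} f-ext le eq {t} t∈E* = ≡.trans (≡.sym (unit (f t))) (≡.trans
        (∑-squeeze {λ t → χₛ E* t ℤ.* f t} {λ t → χₛ E* t ℤ.* + (M ℕ.* r)}
          (λ e → ≡.cong₂ ℤ._*_ (χₛ-ext E* e) (f-ext e)) (λ e → ≡.cong (ℤ._* + (M ℕ.* r)) (χₛ-ext E* e)) le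
          (ℤₚ.≤-reflexive (≡.trans ∣E*∣*Mr (≡.sym eq))) t)
        (unit (+ (M ℕ.* r))))
      where
      unit : ∀ k → χₛ E* t ℤ.* k ≡ k
      unit k = ≡.trans (≡.cong (ℤ._* k) (χ-yes (mem? E* t) t∈E*)) (ℤₚ.*-identityˡ k)

    -- Equality in the triangle inequality: depending on the sign of `total`, either all terms or
    -- all their negatives reach the maximum `M r`.
    equality⇒∣term∣ : ∣ dev c ∣ ≡ bound → ∀ {t} → mem E* t → ∣ term t ∣ ≡ M ℕ.* r
    equality⇒∣term∣ eq {t} t∈E* with ℤₚ.+∣i∣≡i⊎+∣i∣≡-i total
    ... | inj₁ e = ≡.cong ∣_∣ (squeeze term-ext term-≤ (≡.trans (≡.sym e) (≡.cong +_ ∣total∣)) t∈E*)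
      where
      ∣total∣ : ∣ total ∣ ≡ r ℕ.* (q ℕ.+ 1) ℕ.* (M ℕ.* r)
      ∣total∣ = ≡.trans (≡.sym ∣scaled-dev∣) (≡.trans (≡.cong (r ℕ.* (q ℕ.* q) ℕ.*_) eq) rqq*bound)
    ... | inj₂ e = ≡.trans (≡.sym (ℤₚ.∣-i∣≡∣i∣ (term t))) (≡.cong ∣_∣
          (squeeze (λ e → ≡.cong ℤ.-_ (term-ext e)) -term-≤ (≡.trans -total (≡.trans (≡.sym e) (≡.cong +_ ∣total∣))) t∈E*))
      where
      ∣total∣ : ∣ total ∣ ≡ r ℕ.* (q ℕ.+ 1) ℕ.* (M ℕ.* r)
      ∣total∣ = ≡.trans (≡.sym ∣scaled-dev∣) (≡.trans (≡.cong (r ℕ.* (q ℕ.* q) ℕ.*_) eq) rqq*bound)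

    -- A product |S_t| |w| = M r with |w| ≤ r and r > 0 rules out |S_t| < M.
    equality⇒kerCond : ∣ dev c ∣ ≡ bound → kerCond
    equality⇒kerCond eq = ∣gaussSum∣≡M⇒kerCond λ {t} t∈E* → ℕₚ.≤-antisym (∣gaussSum∣≤M t∈E*) (ℕₚ.≮⇒≥ λ S<M →
      ℕₚ.<⇒≢ (ℕₚ.≤-<-trans (ℕₚ.*-monoʳ-≤ ∣ gaussSum t ∣ (∣weight∣≤r c t)) (ℕₚ.*-monoˡ-< r S<M))
        (≡.trans (≡.sym (ℤₚ.abs-* (gaussSum t) (weight c t))) (equality⇒∣term∣ eq t∈E*)))

    kerCond⇒total : kerCond → total ≡ ε ℤ.* + M ℤ.* ∑ (λ t → χₛ E* t ℤ.* weight c t)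
    kerCond⇒total ker = ≡.trans (∑-cong (λ t → ≡.trans (χ*-cong (mem? E* t) (λ t∈E* → ≡.cong (ℤ._* weight c t) (kerCond⇒gaussSum ker t∈E*)))
        (shuffle (χₛ E* t) (ε ℤ.* + M) (weight c t)))) (∑-*ˡ (ε ℤ.* + M) (λ t → χₛ E* t ℤ.* weight c t))
      where
      shuffle : ∀ a b c → a ℤ.* (b ℤ.* c) ≡ b ℤ.* (a ℤ.* c)
      shuffle = solve-∀

    ∣ε∣≡1 : ∣ ε ∣ ≡ 1
    ∣ε∣≡1 with -1^-cases (n ∸ 1)
    ... | inj₁ e = ≡.cong ∣_∣ e
    ... | inj₂ e = ≡.cong ∣_∣ e

    kerCond⇒dev : kerCond → c ≈ 0# → dev c ≡ ε ℤ.* + bound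
    kerCond⇒dev ker c≈0 = ℤₚ.*-cancelˡ-≡ (+ (r ℕ.* (q ℕ.* q))) (dev c) (ε ℤ.* + bound) {{ℤ.≢-nonZero (λ e → ℕ.≢-nonZero⁻¹ (r ℕ.* (q ℕ.* q)) (ℤₚ.+-injective e))}}
      (≡.trans scaled-dev (≡.trans (kerCond⇒total ker) (≡.trans (≡.cong (ε ℤ.* + M ℤ.*_) (∑-weight-0 c c≈0))
        (≡.trans (shuffle₁ ε (+ M) (+ r ℤ.* (qℤ ℤ.+ 1ℤ)) (+ r)) (≡.trans (≡.cong (ε ℤ.*_) (≡.sym product)) (shuffle₂ ε (+ (r ℕ.* (q ℕ.* q))) (+ bound)))))))
      where
      shuffle₁ : ∀ e M a r → e ℤ.* M ℤ.* (a ℤ.* r) ≡ e ℤ.* (a ℤ.* (M ℤ.* r))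
      shuffle₁ = solve-∀
      shuffle₂ : ∀ e a b → e ℤ.* (a ℤ.* b) ≡ a ℤ.* (e ℤ.* b)
      shuffle₂ = solve-∀
      product : + (r ℕ.* (q ℕ.* q)) ℤ.* + bound ≡ + r ℤ.* (qℤ ℤ.+ 1ℤ) ℤ.* (+ M ℤ.* + r)
      product = ≡.trans (≡.sym (ℤₚ.pos-* (r ℕ.* (q ℕ.* q)) bound)) (≡.trans (≡.cong +_ rqq*bound)
        (≡.trans (ℤₚ.pos-* (r ℕ.* (q ℕ.+ 1)) (M ℕ.* r)) (≡.cong₂ ℤ._*_ (≡.trans (≡.sym ∣E*∣) ∣E*∣ℤ) (ℤₚ.pos-* M r))))

    kerCond⇒equality : kerCond → c ≈ 0# → ∣ dev c ∣ ≡ bound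
    kerCond⇒equality ker c≈0 = ≡.trans (≡.cong ∣_∣ (kerCond⇒dev ker c≈0))
      (≡.trans (ℤₚ.abs-* ε (+ bound)) (≡.trans (≡.cong (ℕ._* bound) ∣ε∣≡1) (ℕₚ.*-identityˡ bound)))

    -- Equality already gives `kerCond`, so all Gauss sums equal `ε M`. For c ≠ 0 the total then has
    -- absolute value M r, while equality demands r (q + 1) M r, and r (q + 1) exceeds 1.
    equality⇒c≈0 : ∣ dev c ∣ ≡ bound → c ≈ 0#
    equality⇒c≈0 eq with c ≟ 0#
    ... | yes c≈0 = c≈0
    ... | no c≉0  = contradiction (ℕₚ.*-cancelʳ-≡ (r ℕ.* (q ℕ.+ 1)) 1 (M ℕ.* r) {{ℕₚ.m*n≢0 M r}}
        (≡.trans (≡.sym rqq*bound) (≡.trans (≡.cong (r ℕ.* (q ℕ.* q) ℕ.*_) (≡.sym eq)) (≡.trans ∣scaled-dev∣ (≡.trans ∣total∣ (≡.sym (ℕₚ.*-identityˡ (M ℕ.* r))))))))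
        (λ e → ℕₚ.<⇒≢ (ℕₚ.<-≤-trans (ℕₚ.<-trans 1<q (ℕₚ.m<m+n q (ℕ.s≤s ℕ.z≤n))) (ℕₚ.m≤n*m (q ℕ.+ 1) r)) (≡.sym e))
      where
      ∣total∣ : ∣ total ∣ ≡ M ℕ.* r
      ∣total∣ = ≡.trans (≡.cong ∣_∣ (≡.trans (kerCond⇒total (equality⇒kerCond eq)) (≡.cong (ε ℤ.* + M ℤ.*_) (∑-weight-≉0 c∈E c≉0))))
        (≡.trans (ℤₚ.abs-* (ε ℤ.* + M) (ℤ.- + r)) (≡.cong₂ ℕ._*_
          (≡.trans (ℤₚ.abs-* ε (+ M)) (≡.trans (≡.cong (ℕ._* M) ∣ε∣≡1) (ℕₚ.*-identityˡ M))) (ℤₚ.∣-i∣≡∣i∣ (+ r))))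

-- Specialisation to the given coefficients

coeff-top : (F : FiniteField) (q n m : ℕ) (a : Fin (suc m) → FiniteField.Carrier F) →
  FiniteField._≈_ F (Setting.coeff F q n m a m) (a (fromℕ< (n<1+n m)))
coeff-top F q n m a with m <? suc m
... | yes _    = FiniteField.refl F
... | no m≮1+m = contradiction (n<1+n m) m≮1+m

coeff-above : (F : FiniteField) (q n m : ℕ) (a : Fin (suc m) → FiniteField.Carrier F) →
  ∀ i → m < i → FiniteField._≈_ F (Setting.coeff F q n m a i) (FiniteField.0# F)
coeff-above F q n m a i m<i with i <? suc m
... | yes i<1+m = contradiction (ℕ.s≤s⁻¹ i<1+m) (ℕₚ.<⇒≱ m<i)
... | no _      = FiniteField.refl F

theorem4p3 : (q n : ℕ) → IsPrimePower q → 1 ≤ n →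
    (F : FiniteField) → FiniteField.size F ≡ q ℕ.^ (2 ℕ.* n) →
    (m : ℕ) → (m<n : m < n) → (a : Fin (suc m) → FiniteField.Carrier F) →
    ¬ (FiniteField._≈_ F (a (fromℕ< (n<1+n m))) (FiniteField.0# F)) →
    let open Setting F q n
        A = coeff m a
        bound = (q ℕ.* q ∸ 1) ℕ.* q ℕ.^ (n ∸ 1 ℕ.+ 2 ℕ.* m)
        dev = λ c → (+ N A c) ℤ.- (+ (q ℕ.^ (2 ℕ.* (n ∸ 1))))
        kerCond = ∀ υ → InU υ → DimKer (λ x → υ * Lstar A x + Lpoly A x) (2 ℕ.* m ℕ.+ 1)
    in ((c : Carrier) → InFq2 c →
          (∣ dev c ∣ ≤ bound) × ((∣ dev c ∣ ≡ bound) ⇔ ((c ≈ 0#) × kerCond)))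
       × (kerCond → dev 0# ≡ (-1ℤ ℤ.^ (n ∸ 1)) ℤ.* (+ bound))
theorem4p3 q n q-pp 1≤n F size≡ m m<n a am≉0 =
    (λ c c∈E → ∣dev∣≤bound c∈E ,
      mk⇔ (λ eq → equality⇒c≈0 c∈E eq , equality⇒kerCond c∈E eq) (λ (c≈0 , ker) → kerCond⇒equality c∈E ker c≈0))
  , λ ker → kerCond⇒dev 0∈E ker refl
  where
  open FiniteField F using (trans; sym; refl)
  open FieldTower q n q-pp 1≤n F size≡ using (0∈E)
  open Conclusion q n q-pp 1≤n F size≡ m m<n (Setting.coeff F q n m a)
    (λ e → am≉0 (trans (sym (coeff-top F q n m a)) e)) (coeff-above F q n m a)
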